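{- Let $r\geq 0$, $s>0$ and $n>0$ be integers. Let $\chi_1,\ldots,\chi_s$ be Dirichlet characters modulo $n$ with conductors $d_1,\ldots,d_s$ respectively, and let $d=\mathrm{lcm}(d_1,\ldots,d_s)$. Let $n_0\mid n$ be the greatest divisor of $n$ such that $n_0$ and $d$ have the same prime factors. Then \[ \sum_{\substack{a_1,\ldots,a_s\in\mathbb{Z}_n^\ast\\ b_1,\ldots,b_r\in\mathbb{Z}_n}}\gcd(a_1-1,\ldots,a_s-1,b_1,\ldots,b_r,n)\,\chi_1(a_1)\cdots\chi_s(a_s) =\varphi(n)\,\sigma_{s+r-1}\!\left(\frac{n_0}{d}\right)\prod_{p^m\,\|\,n/n_0}\left(\varphi(p^m)^{s-1}p^{mr}+\sigma_{s+r-1}(p^m)-p^{m(s+r-1)}\right), \] where the product runs over the primes $p$ dividing $n/n_0$ and $p^m\,\|\,n/n_0$ means $p^m$ exactly divides $n/n_0$.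
   Context: $\mathbb{Z}_n=\mathbb{Z}/n\mathbb{Z}$ and $\mathbb{Z}_n^\ast$ is its group of units; the gcd is computed using any integer representatives (it is well defined since $n$ is among the arguments). $\varphi$ is Euler's totient function and $\sigma_k(N)=\sum_{e\mid N}e^k$ is the divisor function. -}

module Defs where

open import Level using (Level; _⊔_)
open import Algebra.Bundles using (CommutativeRing)
open import Data.Nat using (ℕ; zero; suc; _+_; _*_; _∸_; _^_; _≤_; _/_)
open import Data.Nat.Divisibility using (_∣_; _∣?_)
open import Data.Nat.Coprimality using (Coprime; coprime?)
open import Data.Nat.GCD using (gcd)
open import Data.Nat.LCM using (lcm)
open import Data.Nat.Primality using (Prime; prime?)
open import Data.List using (List; []; _∷_; upTo; filter; length; map; concatMap; foldr; _++_)
open import Data.Nat.ListAction using (sum; product)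
open import Data.Vec as Vec using (Vec; []; _∷_; toList; lookup)
open import Data.Fin using (Fin)
open import Data.Empty using (⊥)
open import Data.Sum using (_⊎_)
open import Data.Product using (_×_)
open import Relation.Nullary using (¬_)
open import Function.Bundles using (_⇔_)

φ : ℕ → ℕ
φ n = length (filter (λ a → coprime? a n) (upTo n))

divisors : ℕ → List ℕ
divisors N = filter (λ e → e ∣? N) (map suc (upTo N))

σ : ℕ → ℕ → ℕ
σ k N = sum (map (λ e → e ^ k) (divisors N))

-- exact division (used only with positive divisor b dividing a)
_div_ : ℕ → ℕ → ℕ
a div zero = zero
a div suc b = a / suc b

-- the exponent m with p^m ∥ N (for a prime p and N ≥ 1):
-- the number of k ∈ [1, N] with p^k ∣ N
expo : ℕ → ℕ → ℕ
expo p N = length (filter (λ k → (p ^ k) ∣? N) (map suc (upTo N)))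

primePowerProduct : ℕ → (ℕ → ℕ → ℕ) → ℕ
primePowerProduct N f =
  product (map (λ p → f p (expo p N))
               (filter (λ p → p ∣? N) (filter prime? (upTo (suc N)))))

SamePrimeFactors : ℕ → ℕ → Set
SamePrimeFactors a b = ∀ p → Prime p → (p ∣ a) ⇔ (p ∣ b)

lcmList : List ℕ → ℕ
lcmList = foldr lcm 1

_≡_[mod_] : ℕ → ℕ → ℕ → Set
a ≡ b [mod d ] = (d ∣ (a ∸ b)) × (d ∣ (b ∸ a))

tuples : List ℕ → (k : ℕ) → List (Vec ℕ k)
tuples xs zero = [] ∷ []
tuples xs (suc k) = concatMap (λ x → map (x ∷_) (tuples xs k)) xs

ℤ/ : ℕ → List ℕ
ℤ/ n = upTo n

units : ℕ → List ℕ
units n = filter (λ a → coprime? a n) (upTo n)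

module _ {c ℓ : Level} (R : CommutativeRing c ℓ) where
  open CommutativeRing R renaming
    (Carrier to A; _+_ to _+ᴿ_; _*_ to _*ᴿ_; 0# to 0ᴿ; 1# to 1ᴿ)

  fromℕ : ℕ → A
  fromℕ zero = 0ᴿ
  fromℕ (suc k) = 1ᴿ +ᴿ fromℕ k

  sumR : List A → A
  sumR = foldr _+ᴿ_ 0ᴿ

  prodR : List A → A
  prodR = foldr _*ᴿ_ 1ᴿ

  record IsCharZeroDomain : Set (c ⊔ ℓ) where
    field
      nontrivial   : ¬ (1ᴿ ≈ 0ᴿ)
      noZeroDiv    : ∀ x y → (x *ᴿ y) ≈ 0ᴿ → (x ≈ 0ᴿ) ⊎ (y ≈ 0ᴿ)
      charZero     : ∀ k → fromℕ (suc k) ≈ 0ᴿ → ⊥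

  -- Dirichlet character modulo n with values in R, viewed as a function on ℤ
  -- restricted to the non-negative representatives (it is n-periodic).
  record DirichletCharacter (n : ℕ) : Set (c ⊔ ℓ) where
    field
      χ          : ℕ → A
      periodic   : ∀ a → χ (a + n) ≈ χ a
      multiplicative : ∀ a b → χ (a * b) ≈ (χ a *ᴿ χ b)
      χ-one      : χ 1 ≈ 1ᴿ
      χ-nonunit  : ∀ a → ¬ Coprime a n → χ a ≈ 0ᴿ

  open DirichletCharacter public

  InducedMod : {n : ℕ} → DirichletCharacter n → ℕ → Set ℓ
  InducedMod {n} X e = ∀ a b → Coprime a n → Coprime b n →
                       a ≡ b [mod e ] → χ X a ≈ χ X b

  IsConductor : {n : ℕ} → DirichletCharacter n → ℕ → Set ℓ
  IsConductor {n} X d =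
    (1 ≤ d) × (d ∣ n) × InducedMod X d ×
    (∀ e → 1 ≤ e → e ∣ n → InducedMod X e → d ≤ e)

  gcdSum : (n s r : ℕ) → (Fin s → DirichletCharacter n) → A
  gcdSum n s r X =
    sumR (concatMap (λ as → map (λ bs →
      fromℕ (foldr gcd n (toList (Vec.map (_∸ 1) as) ++ toList bs))
        *ᴿ prodR (toList (Vec.tabulate (λ i → χ (X i) (lookup as i)))))
      (tuples (ℤ/ n) r))
      (tuples (units n) s))

{-# OPTIONS --safe #-}
-- Write gcd(a₁ - 1, …, b_r, n) as the sum of φ(e) over the e ∣ n dividing all its arguments and
-- exchange the sums: for each e the b_j contribute (n/e)^r, and a_i contributes the sum of χ_i over
-- the kernel K of the reduction (ℤ/n)* → (ℤ/e)*. By orthogonality that sum is |K| when χ_i is trivial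
-- on K, i.e. when d_i ∣ e, and 0 otherwise. As φ(e) |K| = φ(n), the total is
--   φ(n) · Σ_{d ∣ e ∣ n} |K|^(s-1) (n/e)^r.
-- By the Chinese remainder theorem the inner sum factors over n = n₀ · (n/n₀) and over prime powers.
-- When e contains every prime of n, |K| = n/e; this covers all terms d ∣ e ∣ n₀, which add up to
-- σ_{s+r-1}(n₀/d), and all divisors e ≠ 1 of a prime power, so that only e = 1 is exceptional there.
module Submission where

open import Defs
open import Level using (Level)
open import Algebra.Bundles using (CommutativeRing; CommutativeSemiring)
import Algebra.Properties.CommutativeSemigroup as CommutativeSemigroupProperties
import Algebra.Properties.Ring as RingProperties
open import Data.Bool using (if_then_else_)
open import Data.Empty using (⊥; ⊥-elim)
open import Data.Fin using (Fin; zero; suc)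
open import Data.List using (List; []; _∷_; upTo; filter; length; map; concatMap; foldr; _++_; cartesianProduct)
open import Data.List.Membership.Propositional using (_∈_)
open import Data.List.Membership.Propositional.Properties using (∈-filter⁺; ∈-filter⁻; ∈-map⁺; ∈-map⁻; ∈-upTo⁺; ∈-upTo⁻; ∈-cartesianProduct⁺; ∈-cartesianProduct⁻)
open import Data.List.Membership.Propositional.Properties.WithK using (unique∧set⇒bag)
open import Data.List.Properties using (length-map; length-upTo)
open import Data.List.Relation.Binary.BagAndSetEquality using (∼bag⇒↭)
open import Data.List.Relation.Binary.Permutation.Propositional using (_↭_)
import Data.List.Relation.Binary.Permutation.Propositional as ↭
open import Data.List.Relation.Binary.Permutation.Propositional.Properties using (↭-length)
open import Data.List.Relation.Unary.All using (All; []; _∷_)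
open import Data.List.Relation.Unary.AllPairs using ([]; _∷_)
open import Data.List.Relation.Unary.Any using (here; there)
open import Data.List.Relation.Unary.Unique.Propositional using (Unique)
import Data.List.Relation.Unary.All as All
import Data.List.Relation.Unary.Unique.Propositional.Properties as Unique
open import Data.Nat using (ℕ; zero; suc; _+_; _*_; _∸_; _^_; _≤_; _<_; z≤n; s≤s; _≟_; NonZero; >-nonZero; ≢-nonZero⁻¹; n>1⇒nonTrivial; nonTrivial⇒n>1)
open import Data.Nat.Coprimality using (Coprime; coprime?; coprime-divisor)
import Data.Nat.Coprimality as Coprimality
open import Data.Nat.Divisibility
open import Data.Nat.DivMod using (_%_; _/_; m%n<n; m<n⇒m%n≡m; [m+kn]%n≡m%n; m≡m%n+[m/n]*n; m*n/n≡m)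
open import Data.Nat.GCD using (gcd; gcd[m,n]∣m; gcd[m,n]∣n; gcd-greatest)
import Data.Nat.GCD as GCD
open import Data.Nat.Induction using (<-rec)
open import Data.Nat.LCM using (lcm; m∣lcm[m,n]; n∣lcm[m,n]; lcm-least)
open import Data.Nat.ListAction using (product)
open import Data.Nat.Primality using (Prime; prime?; euclidsLemma; prime⇒nonZero; prime⇒nonTrivial; prime⇒irreducible; prime[2]; ¬prime[1])
open import Data.Nat.Primality.Factorisation using (factorise)
open import Data.Nat.Properties
open import Data.Nat.Tactic.RingSolver using (solve-∀)
open import Data.Product using (∃; _×_; _,_; proj₁; proj₂)
open import Data.Sum using (_⊎_; inj₁; inj₂; [_,_]′)
open import Data.Vec as Vec using (Vec; []; _∷_; lookup)
open import Data.Vec.Functional using (toList)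
open import Function using (_∘_; id; mk⇔)
open import Function.Bundles using (Equivalence)
open import Relation.Nullary using (¬_; Dec; yes; no; does)
open import Relation.Nullary.Decidable using (map′)
open import Relation.Binary.PropositionalEquality using (_≡_; _≢_; refl; sym; trans; cong; cong₂; subst; subst₂; module ≡-Reasoning)
import Relation.Binary.Reasoning.Setoid as SetoidReasoning

-- Finite sums over lists in a commutative semiring

-- Orthogonality needs "trivial on K implies d_i ∣ e", but a conductor is only defined as the least
-- modulus inducing χ_i. The bridge is that the kernels for d and e together generate the kernel for
-- gcd(d, e): a unit u that is 1 modulo the gcd is v times u/v, with v congruent to u modulo d and
-- to 1 modulo e. Finding such a v that is moreover a unit modulo n is the one place where
-- solvability of congruences to non-coprime moduli enters. Each character sum over K turns out to
-- be the image under `fromℕ` of a natural number, so the ring then disappears and the remaining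
-- evaluation takes place in ℕ. The local factor is σ_{s+r-1}(p^m) with a single summand exchanged:
-- if |K| were n/e for e = 1 too, that divisor would contribute p^(m(s+r-1)), but |K| is φ(p^m)
-- there, which gives φ(p^m)^(s-1) p^(mr).

private
  variable
    A B : Set

∈-injective⇒Unique-map : (g : A → B) {xs : List A} → Unique xs →
  (∀ {x y} → x ∈ xs → y ∈ xs → g x ≡ g y → x ≡ y) → Unique (map g xs)
∈-injective⇒Unique-map g [] inj = []
∈-injective⇒Unique-map g (x≉ ∷ u) inj =
  All.tabulate fresh ∷ ∈-injective⇒Unique-map g u (λ p q → inj (there p) (there q))
  where
  fresh : ∀ {y} → y ∈ map g _ → g _ ≢ y
  fresh p eq with ∈-map⁻ g p
  ... | z , z∈ , refl = All.lookup x≉ z∈ (inj (here refl) (there z∈) eq)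

-- Injectivity is asked only on the entries of `xs`, because the maps in use, such as reduction
-- modulo n, are not injective on all of ℕ. Uniqueness of both lists makes equality of their sets of
-- entries enough for a permutation.
record BijectionOn (g : A → B) (xs : List A) (ys : List B) : Set where
  field
    uniqueˡ    : Unique xs
    uniqueʳ    : Unique ys
    maps-to    : ∀ {x} → x ∈ xs → g x ∈ ys
    injective  : ∀ {x y} → x ∈ xs → y ∈ xs → g x ≡ g y → x ≡ y
    surjective : ∀ {y} → y ∈ ys → ∃ λ x → x ∈ xs × y ≡ g x

map-↭ : {g : A → B} {xs : List A} {ys : List B} → BijectionOn g xs ys → map g xs ↭ ys
map-↭ {g = g} {xs} {ys} bij =
  ∼bag⇒↭ (unique∧set⇒bag (∈-injective⇒Unique-map g uniqueˡ injective) uniqueʳ (mk⇔ to from))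
  where
  open BijectionOn bij
  to : ∀ {z} → z ∈ map g xs → z ∈ ys
  to p with ∈-map⁻ g p
  ... | x , x∈ , refl = maps-to x∈
  from : ∀ {z} → z ∈ ys → z ∈ map g xs
  from p with surjective p
  ... | x , x∈ , refl = ∈-map⁺ g x∈

unique-set⇒↭ : {xs ys : List A} → Unique xs → Unique ys →
  (∀ {x} → x ∈ xs → x ∈ ys) → (∀ {x} → x ∈ ys → x ∈ xs) → xs ↭ ys
unique-set⇒↭ u v to from = ∼bag⇒↭ (unique∧set⇒bag u v (mk⇔ to from))

module Summation {c ℓ : Level} (S : CommutativeSemiring c ℓ) where
  open CommutativeSemiring S using (_≈_)
    renaming (Carrier to C; _+_ to _⊕_; _*_ to _⊗_; 0# to 𝟘; 1# to 𝟙; +-cong to ⊕-cong; *-cong to ⊗-cong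
             ; +-identityˡ to ⊕-identityˡ; +-identityʳ to ⊕-identityʳ; +-assoc to ⊕-assoc
             ; *-identityˡ to ⊗-identityˡ; *-identityʳ to ⊗-identityʳ; *-comm to ⊗-comm)
  private
    module E = CommutativeSemiring S
    module +P = CommutativeSemigroupProperties E.+-commutativeSemigroup
    module *P = CommutativeSemigroupProperties E.*-commutativeSemigroup
  open SetoidReasoning E.setoid

  total : List C → C
  total = foldr _⊕_ 𝟘

  ∑ : List A → (A → C) → C
  ∑ xs f = total (map f xs)

  𝟙[_] : {P : Set} → Dec P → C
  𝟙[ p ] = if does p then 𝟙 else 𝟘

  ∏ : (k : ℕ) → (Fin k → C) → C
  ∏ zero    f = 𝟙
  ∏ (suc k) f = f zero ⊗ ∏ k (f ∘ suc)

  𝟙-true : {P : Set} (p : Dec P) → P → 𝟙[ p ] ≈ 𝟙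
  𝟙-true (yes _) _ = E.refl
  𝟙-true (no ¬p) p = ⊥-elim (¬p p)

  𝟙-false : {P : Set} (p : Dec P) → ¬ P → 𝟙[ p ] ≈ 𝟘
  𝟙-false (yes p) ¬p = ⊥-elim (¬p p)
  𝟙-false (no _)  _  = E.refl

  𝟙-cong : {P Q : Set} (p : Dec P) (q : Dec Q) → (P → Q) → (Q → P) → 𝟙[ p ] ≈ 𝟙[ q ]
  𝟙-cong (yes p) q f g = E.sym (𝟙-true q (f p))
  𝟙-cong (no ¬p) q f g = E.sym (𝟙-false q (¬p ∘ g))

  𝟙-× : {P Q T : Set} (p : Dec P) (q : Dec Q) (t : Dec T) →
    (P → Q) → (P → T) → (Q → T → P) → 𝟙[ p ] ≈ 𝟙[ q ] ⊗ 𝟙[ t ]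
  𝟙-× p (yes q) t pq pt qtp = E.trans (𝟙-cong p t pt (qtp q)) (E.sym (⊗-identityˡ _))
  𝟙-× p (no ¬q) t pq pt qtp = E.trans (𝟙-false p (¬q ∘ pq)) (E.sym (E.zeroˡ _))

  𝟙-guard : {P : Set} (p : Dec P) {x y : C} → (P → x ≈ y) → 𝟙[ p ] ⊗ x ≈ 𝟙[ p ] ⊗ y
  𝟙-guard (yes p) h = ⊗-cong E.refl (h p)
  𝟙-guard (no _)  h = E.trans (E.zeroˡ _) (E.sym (E.zeroˡ _))

  ∑-cong : (xs : List A) {f g : A → C} → (∀ {x} → x ∈ xs → f x ≈ g x) → ∑ xs f ≈ ∑ xs g
  ∑-cong []       h = E.refl
  ∑-cong (x ∷ xs) h = ⊕-cong (h (here refl)) (∑-cong xs (h ∘ there))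

  ∑-zero : (xs : List A) {f : A → C} → (∀ {x} → x ∈ xs → f x ≈ 𝟘) → ∑ xs f ≈ 𝟘
  ∑-zero []       h = E.refl
  ∑-zero (x ∷ xs) h = E.trans (⊕-cong (h (here refl)) (∑-zero xs (h ∘ there))) (⊕-identityˡ 𝟘)

  ∑-++ : (xs ys : List A) (f : A → C) → ∑ (xs ++ ys) f ≈ ∑ xs f ⊕ ∑ ys f
  ∑-++ []       ys f = E.sym (⊕-identityˡ _)
  ∑-++ (x ∷ xs) ys f = E.trans (⊕-cong E.refl (∑-++ xs ys f)) (E.sym (⊕-assoc _ _ _))

  ∑-map : (g : A → B) (xs : List A) (f : B → C) → ∑ (map g xs) f ≈ ∑ xs (f ∘ g)
  ∑-map g []       f = E.refl
  ∑-map g (x ∷ xs) f = ⊕-cong E.refl (∑-map g xs f)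

  ∑-concatMap : (g : A → List B) (xs : List A) (f : B → C) → ∑ (concatMap g xs) f ≈ ∑ xs (λ x → ∑ (g x) f)
  ∑-concatMap g []       f = E.refl
  ∑-concatMap g (x ∷ xs) f =
    E.trans (∑-++ (g x) (concatMap g xs) f) (⊕-cong E.refl (∑-concatMap g xs f))

  ∑-⊕ : (xs : List A) (f g : A → C) → ∑ xs (λ x → f x ⊕ g x) ≈ ∑ xs f ⊕ ∑ xs g
  ∑-⊕ []       f g = E.sym (⊕-identityˡ 𝟘)
  ∑-⊕ (x ∷ xs) f g = E.trans (⊕-cong E.refl (∑-⊕ xs f g)) (+P.interchange _ _ _ _)

  ∑-distribˡ : (c : C) (xs : List A) (f : A → C) → ∑ xs (λ x → c ⊗ f x) ≈ c ⊗ ∑ xs f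
  ∑-distribˡ c []       f = E.sym (E.zeroʳ c)
  ∑-distribˡ c (x ∷ xs) f = E.trans (⊕-cong E.refl (∑-distribˡ c xs f)) (E.sym (E.distribˡ _ _ _))

  ∑-distribʳ : (xs : List A) (f : A → C) (c : C) → ∑ xs (λ x → f x ⊗ c) ≈ ∑ xs f ⊗ c
  ∑-distribʳ xs f c =
    E.trans (∑-cong xs λ _ → ⊗-comm _ _) (E.trans (∑-distribˡ c xs f) (⊗-comm _ _))

  ∑-swap : (xs : List A) (ys : List B) (f : A → B → C) →
    ∑ xs (λ x → ∑ ys (f x)) ≈ ∑ ys (λ y → ∑ xs (λ x → f x y))
  ∑-swap []       ys f = E.sym (∑-zero ys λ _ → E.refl)
  ∑-swap (x ∷ xs) ys f =
    E.trans (⊕-cong E.refl (∑-swap xs ys f)) (E.sym (∑-⊕ ys (f x) (λ y → ∑ xs (λ x → f x y))))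

  ∑-product : (xs : List A) (ys : List B) (f : A → C) (g : B → C) →
    ∑ xs (λ x → ∑ ys (λ y → f x ⊗ g y)) ≈ ∑ xs f ⊗ ∑ ys g
  ∑-product xs ys f g = E.trans (∑-cong xs λ _ → ∑-distribˡ _ ys g) (∑-distribʳ xs f (∑ ys g))

  ∑-filter : {P : A → Set} (P? : ∀ x → Dec (P x)) (xs : List A) (f : A → C) →
    ∑ (filter P? xs) f ≈ ∑ xs (λ x → 𝟙[ P? x ] ⊗ f x)
  ∑-filter P? []       f = E.refl
  ∑-filter P? (x ∷ xs) f with P? x
  ... | yes _ = ⊕-cong (E.sym (⊗-identityˡ _)) (∑-filter P? xs f)
  ... | no  _ = E.trans (∑-filter P? xs f) (E.sym (E.trans (⊕-cong (E.zeroˡ _) E.refl) (⊕-identityˡ _)))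

  -- The device for counting by fibres: a summand is replaced by a sum of indicators over the
  -- possible values of an invariant, and the two sums are then exchanged.
  ∑-delta : {P : A → Set} (P? : ∀ x → Dec (P x)) {xs : List A} {z : A} → Unique xs → z ∈ xs → P z →
    (∀ {x} → x ∈ xs → P x → x ≡ z) → (f : A → C) → ∑ xs (λ x → 𝟙[ P? x ] ⊗ f x) ≈ f z
  ∑-delta P? {y ∷ ys} (x≉ ∷ u) (here refl) pz only f = begin
    𝟙[ P? y ] ⊗ f y ⊕ ∑ ys (λ x → 𝟙[ P? x ] ⊗ f x)
      ≈⟨ ⊕-cong (⊗-cong (𝟙-true (P? y) pz) E.refl) (∑-zero ys λ {x} x∈ →
           E.trans (⊗-cong (𝟙-false (P? x) λ px → All.lookup x≉ x∈ (sym (only (there x∈) px))) E.refl) (E.zeroˡ _)) ⟩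
    𝟙 ⊗ f y ⊕ 𝟘 ≈⟨ E.trans (⊕-identityʳ _) (⊗-identityˡ _) ⟩
    f y ∎
  ∑-delta P? {y ∷ ys} {z} (x≉ ∷ u) (there z∈) pz only f = begin
    𝟙[ P? y ] ⊗ f y ⊕ ∑ ys (λ x → 𝟙[ P? x ] ⊗ f x)
      ≈⟨ ⊕-cong (⊗-cong (𝟙-false (P? y) λ py → All.lookup x≉ z∈ (only (here refl) py)) E.refl)
                (∑-delta P? u z∈ pz (only ∘ there) f) ⟩
    𝟘 ⊗ f y ⊕ f z ≈⟨ E.trans (⊕-cong (E.zeroˡ _) E.refl) (⊕-identityˡ _) ⟩
    f z ∎

  ∑-↭ : {xs ys : List A} (f : A → C) → xs ↭ ys → ∑ xs f ≈ ∑ ys f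
  ∑-↭ f ↭.refl         = E.refl
  ∑-↭ f (↭.prep x p)   = ⊕-cong E.refl (∑-↭ f p)
  ∑-↭ f (↭.swap x y p) = E.trans (⊕-cong E.refl (⊕-cong E.refl (∑-↭ f p))) (+P.x∙yz≈y∙xz _ _ _)
  ∑-↭ f (↭.trans p q)  = E.trans (∑-↭ f p) (∑-↭ f q)

  ∑-reindex : {g : A → B} {xs : List A} {ys : List B} → BijectionOn g xs ys →
    (f : B → C) → ∑ xs (f ∘ g) ≈ ∑ ys f
  ∑-reindex {g = g} {xs} bij f = E.trans (E.sym (∑-map g xs f)) (∑-↭ f (map-↭ bij))

  ∑-cartesianProduct : (xs : List A) (ys : List B) (f : A → B → C) →
    ∑ (cartesianProduct xs ys) (λ z → f (proj₁ z) (proj₂ z)) ≈ ∑ xs (λ x → ∑ ys (f x))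
  ∑-cartesianProduct []       ys f = E.refl
  ∑-cartesianProduct (x ∷ xs) ys f = E.trans (∑-++ (map (x ,_) ys) (cartesianProduct xs ys) _)
    (⊕-cong (∑-map (x ,_) ys _) (∑-cartesianProduct xs ys f))

  ∏-cong : (k : ℕ) {f g : Fin k → C} → (∀ i → f i ≈ g i) → ∏ k f ≈ ∏ k g
  ∏-cong zero    h = E.refl
  ∏-cong (suc k) h = ⊗-cong (h zero) (∏-cong k (h ∘ suc))

  ∏-⊗ : (k : ℕ) (f g : Fin k → C) → ∏ k (λ i → f i ⊗ g i) ≈ ∏ k f ⊗ ∏ k g
  ∏-⊗ zero    f g = E.sym (⊗-identityˡ 𝟙)
  ∏-⊗ (suc k) f g = E.trans (⊗-cong E.refl (∏-⊗ k _ _)) (*P.interchange _ _ _ _)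

  -- This separates the variables once the gcd condition has become a product of conditions on
  -- single entries.
  ∑-tuples : (xs : List ℕ) (k : ℕ) (f : Fin k → ℕ → C) →
    ∑ (tuples xs k) (λ as → ∏ k (λ i → f i (lookup as i))) ≈ ∏ k (λ i → ∑ xs (f i))
  ∑-tuples xs zero    f = ⊕-identityʳ 𝟙
  ∑-tuples xs (suc k) f = begin
    ∑ (tuples xs (suc k)) (λ as → ∏ (suc k) (λ i → f i (lookup as i)))
      ≈⟨ ∑-concatMap (λ x → map (x ∷_) (tuples xs k)) xs _ ⟩
    ∑ xs (λ x → ∑ (map (x ∷_) (tuples xs k)) (λ as → ∏ (suc k) (λ i → f i (lookup as i))))
      ≈⟨ ∑-cong xs (λ {x} _ → ∑-map (x ∷_) (tuples xs k) _) ⟩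
    ∑ xs (λ x → ∑ (tuples xs k) (λ as → f zero x ⊗ ∏ k (λ i → f (suc i) (lookup as i))))
      ≈⟨ ∑-product xs (tuples xs k) (f zero) _ ⟩
    ∑ xs (f zero) ⊗ ∑ (tuples xs k) (λ as → ∏ k (λ i → f (suc i) (lookup as i)))
      ≈⟨ ⊗-cong E.refl (∑-tuples xs k (f ∘ suc)) ⟩
    ∏ (suc k) (λ i → ∑ xs (f i)) ∎

  total-concatMap : (g : A → List C) (xs : List A) → total (concatMap g xs) ≈ ∑ xs (total ∘ g)
  total-concatMap g []       = E.refl
  total-concatMap g (x ∷ xs) = E.trans (total-++ (g x)) (⊕-cong E.refl (total-concatMap g xs))
    where
    total-++ : ∀ ys {zs} → total (ys ++ zs) ≈ total ys ⊕ total zs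
    total-++ []       = E.sym (⊕-identityˡ _)
    total-++ (y ∷ ys) = E.trans (⊕-cong E.refl (total-++ ys)) (E.sym (⊕-assoc _ _ _))

-- Congruences, units and valuations

-- Subtraction-free congruence: the differences of a and b modulo e are absorbed on both sides.
infix 4 _≅_⟨_⟩
record _≅_⟨_⟩ (a b e : ℕ) : Set where
  constructor shifted
  field
    x y   : ℕ
    equal : a + x * e ≡ b + y * e

≅-refl : ∀ {a e} → a ≅ a ⟨ e ⟩
≅-refl = shifted 0 0 refl

≅-sym : ∀ {a b e} → a ≅ b ⟨ e ⟩ → b ≅ a ⟨ e ⟩
≅-sym (shifted x y eq) = shifted y x (sym eq)

≅-trans : ∀ {a b c e} → a ≅ b ⟨ e ⟩ → b ≅ c ⟨ e ⟩ → a ≅ c ⟨ e ⟩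
≅-trans {a} {b} {c} {e} (shifted x y eq) (shifted z w eq′) = shifted (x + z) (w + y) (begin
  a + (x + z) * e   ≡⟨ ring₁ a x z e ⟩
  a + x * e + z * e ≡⟨ cong (_+ z * e) eq ⟩
  b + y * e + z * e ≡⟨ ring₂ b y z e ⟩
  b + z * e + y * e ≡⟨ cong (_+ y * e) eq′ ⟩
  c + w * e + y * e ≡⟨ sym (ring₁ c w y e) ⟩
  c + (w + y) * e   ∎)
  where
  open ≡-Reasoning
  ring₁ : ∀ a x z e → a + (x + z) * e ≡ a + x * e + z * e
  ring₁ = solve-∀
  ring₂ : ∀ b y z e → b + y * e + z * e ≡ b + z * e + y * e
  ring₂ = solve-∀

≅-* : ∀ {a b c d e} → a ≅ b ⟨ e ⟩ → c ≅ d ⟨ e ⟩ → a * c ≅ b * d ⟨ e ⟩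
≅-* {a} {b} {c} {d} {e} (shifted x y eq) (shifted z w eq′) =
  shifted (a * z + x * c + x * z * e) (b * w + y * d + y * w * e)
    (trans (expand a x c z e) (trans (cong₂ _*_ eq eq′) (sym (expand b y d w e))))
  where
  expand : ∀ a x c z e → a * c + (a * z + x * c + x * z * e) * e ≡ (a + x * e) * (c + z * e)
  expand = solve-∀

≅-+multiple : ∀ a k e → a + k * e ≅ a ⟨ e ⟩
≅-+multiple a k e = shifted 0 k (+-identityʳ _)

≅-coarsen : ∀ {a b e f} → f ∣ e → a ≅ b ⟨ e ⟩ → a ≅ b ⟨ f ⟩
≅-coarsen {a} {b} {f = f} (divides q refl) (shifted x y eq) =
  shifted (x * q) (y * q) (trans (cong (a +_) (*-assoc x q f)) (trans eq (cong (b +_) (sym (*-assoc y q f)))))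

≅-% : ∀ a e .{{_ : NonZero e}} → a % e ≅ a ⟨ e ⟩
≅-% a e = shifted (a / e) 0 (trans (sym (m≡m%n+[m/n]*n a e)) (sym (+-identityʳ a)))

≅⇒%≡ : ∀ {a b e} .{{_ : NonZero e}} → a ≅ b ⟨ e ⟩ → a % e ≡ b % e
≅⇒%≡ {a} {b} {e} (shifted x y eq) =
  trans (sym ([m+kn]%n≡m%n a x e)) (trans (cong (_% e) eq) ([m+kn]%n≡m%n b y e))

%≡⇒≅ : ∀ {a b e} .{{_ : NonZero e}} → a % e ≡ b % e → a ≅ b ⟨ e ⟩
%≡⇒≅ {a} {b} {e} eq = ≅-trans (≅-sym (≅-% a e)) (subst (_≅ b ⟨ e ⟩) (sym eq) (≅-% b e))

≅∧<⇒≡ : ∀ {a b e} → a < e → b < e → a ≅ b ⟨ e ⟩ → a ≡ b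
≅∧<⇒≡ {a} {b} {suc e} a<e b<e a≅b =
  trans (sym (m<n⇒m%n≡m a<e)) (trans (≅⇒%≡ a≅b) (m<n⇒m%n≡m b<e))

≅⇒∣ : ∀ {a k e} → a + k ≅ a ⟨ e ⟩ → e ∣ k
≅⇒∣ {a} {k} {e} (shifted x y eq) =
  ∣m+n∣m⇒∣n (divides y (+-cancelˡ-≡ a _ _ (trans (rearrange a k x e) eq))) (n∣m*n x)
  where
  rearrange : ∀ a k x e → a + (x * e + k) ≡ a + k + x * e
  rearrange = solve-∀

∣⇒≅ : ∀ {a k e} → e ∣ k → a + k ≅ a ⟨ e ⟩
∣⇒≅ {a} (divides q refl) = ≅-+multiple a q _

∣-resp-≅ : ∀ {a b d e} → d ∣ e → a ≅ b ⟨ e ⟩ → d ∣ b → d ∣ a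
∣-resp-≅ {a} {b} {d} {e} d∣e (shifted x y eq) d∣b =
  ∣m+n∣m⇒∣n (subst (d ∣_) (trans (sym eq) (+-comm a _)) (∣m∣n⇒∣m+n d∣b (∣n⇒∣m*n y d∣e))) (∣n⇒∣m*n x d∣e)

Coprime-resp-≅ : ∀ {a b e} → a ≅ b ⟨ e ⟩ → Coprime b e → Coprime a e
Coprime-resp-≅ a≅b cop (d∣a , d∣e) = cop (∣-resp-≅ d∣e (≅-sym a≅b) d∣a , d∣e)

≅⇒[mod] : ∀ {a b e} → a ≅ b ⟨ e ⟩ → a ≡ b [mod e ]
≅⇒[mod] a≅b = half a≅b , half (≅-sym a≅b)
  where
  half : ∀ {a b e} → a ≅ b ⟨ e ⟩ → e ∣ a ∸ b
  half {a} {b} {e} a≅b with ≤-total a b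
  ... | inj₁ a≤b = subst (e ∣_) (sym (m≤n⇒m∸n≡0 a≤b)) (e ∣0)
  ... | inj₂ b≤a = ≅⇒∣ (subst (_≅ b ⟨ e ⟩) (sym (m+[n∸m]≡n b≤a)) a≅b)

[mod]⇒≅ : ∀ {a b e} → a ≡ b [mod e ] → a ≅ b ⟨ e ⟩
[mod]⇒≅ {a} {b} {e} (e∣a∸b , e∣b∸a) with ≤-total a b
... | inj₁ a≤b = ≅-sym (subst (_≅ a ⟨ e ⟩) (m+[n∸m]≡n a≤b) (∣⇒≅ e∣b∸a))
... | inj₂ b≤a = subst (_≅ b ⟨ e ⟩) (m+[n∸m]≡n b≤a) (∣⇒≅ e∣a∸b)

-- Coprimality, inverses and the Chinese remainder theorem

Coprime-* : ∀ {a b m} → Coprime a m → Coprime b m → Coprime (a * b) m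
Coprime-* {a} copa copb {d} (d∣ab , d∣m) =
  copb (coprime-divisor (λ (i∣d , i∣a) → copa (i∣a , ∣-trans i∣d d∣m)) d∣ab , d∣m)

Coprime-^ : ∀ {a m} k → Coprime a m → Coprime (a ^ k) m
Coprime-^ zero    cop = Coprimality.1-coprimeTo _
Coprime-^ {a} (suc k) cop = Coprime-* {a} {a ^ k} cop (Coprime-^ {a} k cop)

Coprime-∣ : ∀ {a b m n} → a ∣ b → m ∣ n → Coprime b n → Coprime a m
Coprime-∣ a∣b m∣n cop (d∣a , d∣m) = cop (∣-trans d∣a a∣b , ∣-trans d∣m m∣n)

coprime⇒*∣ : ∀ {m n k} → Coprime m n → m ∣ k → n ∣ k → m * n ∣ k
coprime⇒*∣ {m} {n} cop (divides q refl) n∣k =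
  subst (_∣ q * m) (*-comm n m) (*-monoˡ-∣ m (coprime-divisor {n} {m} {q} (Coprimality.sym cop)
    (subst (n ∣_) (*-comm q m) n∣k)))

primeDivisor : ∀ {n} → n ≢ 1 → ∃ λ p → Prime p × p ∣ n
primeDivisor {zero} _ = 2 , prime[2] , 2 ∣0
primeDivisor {suc n} n≢1 with factorise (suc n)
... | record { factors = []     ; isFactorisation = eq } = ⊥-elim (n≢1 eq)
... | record { factors = p ∷ ps ; isFactorisation = eq ; factorsPrime = prime-p ∷ _ } =
  p , prime-p , subst (p ∣_) (sym eq) (m∣m*n (product ps))

prime≢1 : ∀ {p} → Prime p → p ≢ 1
prime≢1 prime-p refl = ¬prime[1] prime-p

no-common-prime⇒coprime : ∀ {a b} → (∀ p → Prime p → p ∣ a → p ∣ b → ⊥) → Coprime a b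
no-common-prime⇒coprime h {d} (d∣a , d∣b) with d ≟ 1
... | yes d≡1 = d≡1
... | no  d≢1 with primeDivisor d≢1
...   | p , prime-p , p∣d = ⊥-elim (h p prime-p (∣-trans p∣d d∣a) (∣-trans p∣d d∣b))

prime∤⇒coprime : ∀ {p a} → Prime p → ¬ p ∣ a → Coprime p a
prime∤⇒coprime prime-p p∤a (d∣p , d∣a) with prime⇒irreducible prime-p d∣p
... | inj₁ d≡1  = d≡1
... | inj₂ refl = ⊥-elim (p∤a d∣a)

-- Both Bézout identities over ℕ give an expression for - gcd d e as a multiple of d modulo e.
negatedBézout : ∀ d e .{{_ : NonZero e}} → ∃ λ k → e ∣ k * d + gcd d e
negatedBézout d (suc e) with GCD.Bézout.identity (GCD.gcd-GCD d (suc e))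
... | GCD.Bézout.+- x y eq = e * x , divides (gcd d (suc e) + e * y) (begin
  e * x * d + g             ≡⟨ cong (_+ g) (*-assoc e x d) ⟩
  e * (x * d) + g           ≡⟨ cong (λ z → e * z + g) (sym eq) ⟩
  e * (g + y * suc e) + g   ≡⟨ ring e g y ⟩
  (g + e * y) * suc e       ∎)
  where
  open ≡-Reasoning
  g = gcd d (suc e)
  ring : ∀ e g y → e * (g + y * suc e) + g ≡ (g + e * y) * suc e
  ring = solve-∀
... | GCD.Bézout.-+ x y eq = x , divides y (trans (+-comm (x * d) _) eq)

negatedInverse : ∀ {a n} .{{_ : NonZero n}} → Coprime a n → ∃ λ k → n ∣ k * a + 1
negatedInverse {a} {n} cop with negatedBézout a n
... | k , n∣ = k , subst (λ g → n ∣ k * a + g) (Coprimality.coprime⇒gcd≡1 cop) n∣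

inverse : ∀ {a n} .{{_ : NonZero n}} → Coprime a n → ∃ λ b → a * b ≅ 1 ⟨ n ⟩ × Coprime b n
inverse {a} {n} cop with negatedInverse cop
-- Modulo `n`, `k * a` is -1, so the inverse of `a` is -k. Writing this -1 as `k * a` turns it into
-- `k * k * a` without subtraction.
... | k , divides q eq = k * k * a , ab≅1 , λ (d∣b , d∣n) →
    ∣1⇒≡1 (∣-resp-≅ d∣n (≅-sym ab≅1) (∣n⇒∣m*n a d∣b))
  where
  open ≡-Reasoning
  ring₁ : ∀ a k → a * (k * k * a) + (k * a + 1) ≡ (k * a) * (k * a + 1) + 1
  ring₁ = solve-∀
  ring₂ : ∀ m q n → m * (q * n) + 1 ≡ 1 + (m * q) * n
  ring₂ = solve-∀
  ab≅1 : a * (k * k * a) ≅ 1 ⟨ n ⟩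
  ab≅1 = shifted q (k * a * q) (begin
    a * (k * k * a) + q * n       ≡⟨ cong (a * (k * k * a) +_) (sym eq) ⟩
    a * (k * k * a) + (k * a + 1) ≡⟨ ring₁ a k ⟩
    (k * a) * (k * a + 1) + 1     ≡⟨ cong (λ z → (k * a) * z + 1) eq ⟩
    (k * a) * (q * n) + 1         ≡⟨ ring₂ (k * a) q n ⟩
    1 + (k * a * q) * n           ∎)

-- Repeatedly cancelling gcd(n, b) from n leaves a t that carries every prime of n not dividing b.
coprimePart : ∀ b n → .{{NonZero n}} → ∃ λ t → Coprime t b × (∀ p → Prime p → p ∣ n → p ∣ t ⊎ p ∣ b)
coprimePart b = <-rec _ step
  where
  step : ∀ n → (∀ {m} → m < n → .{{NonZero m}} → ∃ λ t → Coprime t b × (∀ p → Prime p → p ∣ m → p ∣ t ⊎ p ∣ b)) →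
    .{{NonZero n}} → ∃ λ t → Coprime t b × (∀ p → Prime p → p ∣ n → p ∣ t ⊎ p ∣ b)
  step n rec with gcd n b ≟ 1
  ... | yes g≡1 = n , Coprimality.gcd≡1⇒coprime g≡1 , λ _ _ → inj₁
  ... | no  g≢1 = let t , cop , split = rec smaller {{quotient≢0 g∣n}} in
    t , cop , λ p prime-p p∣n →
      [ split p prime-p , (λ p∣g → inj₂ (∣-trans p∣g (gcd[m,n]∣n n b))) ]′
        (euclidsLemma (quotient g∣n) (gcd n b) prime-p (subst (p ∣_) (m∣n⇒n≡quotient*m g∣n) p∣n))
    where
    g∣n = gcd[m,n]∣m n b
    smaller : quotient g∣n < n
    smaller = quotient-< g∣n {{n>1⇒nonTrivial (≤∧≢⇒< (n≢0⇒n>0 (GCD.gcd[m,n]≢0 n b (inj₁ (≢-nonZero⁻¹ n)))) (g≢1 ∘ sym))}}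

-- Add to `b` the multiple `t * l`, where `t` carries the primes of `n` that do not divide `b`. A
-- prime of `n` dividing `t` does not divide `b`; one dividing `b` divides neither `t` nor `l`. In
-- both cases it divides exactly one of the two summands.
unit-lift : ∀ {b l} n .{{_ : NonZero n}} → Coprime b l → ∃ λ a → a ≅ b ⟨ l ⟩ × Coprime a n
unit-lift {b} {l} n cop with coprimePart b n
... | t , cop-t , split = b + t * l , ≅-+multiple b t l , no-common-prime⇒coprime common
  where
  common : ∀ p → Prime p → p ∣ b + t * l → p ∣ n → ⊥
  common p prime-p p∣a p∣n with split p prime-p p∣n
  ... | inj₁ p∣t = prime≢1 prime-p (cop-t (p∣t ,
          ∣m+n∣m⇒∣n (subst (p ∣_) (+-comm b (t * l)) p∣a) (∣m⇒∣m*n l p∣t)))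
  ... | inj₂ p∣b with euclidsLemma t l prime-p (∣m+n∣m⇒∣n p∣a p∣b)
  ...   | inj₁ p∣t = prime≢1 prime-p (cop-t (p∣t , p∣b))
  ...   | inj₂ p∣l = prime≢1 prime-p (cop (p∣b , p∣l))

chineseRemainder : ∀ {m n} .{{_ : NonZero n}} → Coprime m n → ∀ a b →
  ∃ λ x → x ≅ a ⟨ m ⟩ × x ≅ b ⟨ n ⟩
chineseRemainder {m} {suc n} cop a b with negatedInverse cop
-- Modulo `suc n`, both `k * m` and `n` are -1. Hence `c` stands for a - b, and a + c k m is a - (a
-- - b) = b.
... | k , divides w eq = a + c * k * m , ≅-+multiple a (c * k) m , shifted b (c * w) (begin
  a + c * k * m + b * suc n ≡⟨ ring₁ a b k m n ⟩
  b + c * (k * m + 1)       ≡⟨ cong (λ z → b + c * z) eq ⟩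
  b + c * (w * suc n)       ≡⟨ cong (b +_) (sym (*-assoc c w (suc n))) ⟩
  b + c * w * suc n         ∎)
  where
  open ≡-Reasoning
  c = a + n * b
  ring₁ : ∀ a b k m n → a + (a + n * b) * k * m + b * suc n ≡ b + (a + n * b) * (k * m + 1)
  ring₁ = solve-∀

≅-combine : ∀ {x y m n} → Coprime m n → x ≅ y ⟨ m ⟩ → x ≅ y ⟨ n ⟩ → x ≅ y ⟨ m * n ⟩
≅-combine {x} {y} {m} {n} cop p q =
  [ (λ x≤y → ≅-sym (ordered x≤y (≅-sym p) (≅-sym q))) , (λ y≤x → ordered y≤x p q) ]′ (≤-total x y)
  where
  ordered : ∀ {x y} → y ≤ x → x ≅ y ⟨ m ⟩ → x ≅ y ⟨ n ⟩ → x ≅ y ⟨ m * n ⟩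
  ordered {x} {y} y≤x p q = subst (_≅ y ⟨ m * n ⟩) eq (∣⇒≅ (coprime⇒*∣ cop
    (≅⇒∣ (subst (_≅ y ⟨ m ⟩) (sym eq) p)) (≅⇒∣ (subst (_≅ y ⟨ n ⟩) (sym eq) q))))
    where eq = m+[n∸m]≡n y≤x

-- Lists of units and divisors, exact quotients

∈-units⁺ : ∀ {a n} → a < n → Coprime a n → a ∈ units n
∈-units⁺ {n = n} a<n cop = ∈-filter⁺ (λ a → coprime? a n) (∈-upTo⁺ a<n) cop

∈-units⁻ : ∀ {a n} → a ∈ units n → a < n × Coprime a n
∈-units⁻ {n = n} a∈ with ∈-filter⁻ (λ a → coprime? a n) {xs = upTo n} a∈
... | a∈upTo , cop = ∈-upTo⁻ a∈upTo , λ {d} → cop {d}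

units-unique : ∀ n → Unique (units n)
units-unique n = Unique.filter⁺ (λ a → coprime? a n) (Unique.upTo⁺ n)

%-∈-units : ∀ {a n} .{{_ : NonZero n}} → Coprime a n → a % n ∈ units n
%-∈-units {a} {n} cop = ∈-units⁺ (m%n<n a n) (Coprime-resp-≅ (≅-% a n) cop)

-- The representative a = 0 occurs only for n = 1, where the truncated 0 ∸ 1 does no harm.
∣∸1⇔≅1 : ∀ {a n e} → a ∈ units n → e ∣ n → (e ∣ a ∸ 1 → a ≅ 1 ⟨ e ⟩) × (a ≅ 1 ⟨ e ⟩ → e ∣ a ∸ 1)
∣∸1⇔≅1 {suc a} {n} {e} _ _ = ∣⇒≅ , ≅⇒∣
∣∸1⇔≅1 {zero} {n} {e} a∈ e∣n = (λ _ → shifted 1 0 e≡1) , λ _ → e ∣0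
  where
  e≡1 : 1 * e ≡ 1
  e≡1 = trans (*-identityˡ e) (∣1⇒≡1 (subst (e ∣_) (Coprimality.0-coprimeTo-m⇒m≡1 (proj₂ (∈-units⁻ a∈))) e∣n))

∈-positive⁺ : ∀ {k n} .{{_ : NonZero k}} → k ≤ n → k ∈ map suc (upTo n)
∈-positive⁺ {suc k} k≤n = ∈-map⁺ suc (∈-upTo⁺ k≤n)

∈-positive⁻ : ∀ {k n} → k ∈ map suc (upTo n) → NonZero k × k ≤ n
∈-positive⁻ k∈ with ∈-map⁻ suc k∈
... | j , j∈ , refl = _ , ∈-upTo⁻ j∈

positive-unique : ∀ n → Unique (map suc (upTo n))
positive-unique n = Unique.map⁺ suc-injective (Unique.upTo⁺ n)

∣⇒nonZero : ∀ {e n} → e ∣ n → .{{NonZero n}} → NonZero e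
∣⇒nonZero {zero}  {n} e∣n = ⊥-elim (≢-nonZero⁻¹ n (0∣⇒≡0 e∣n))
∣⇒nonZero {suc e} e∣n = _

∈-divisors⁺ : ∀ {e n} .{{_ : NonZero n}} → e ∣ n → e ∈ divisors n
∈-divisors⁺ {e} {n} e∣n =
  ∈-filter⁺ (λ e → e ∣? n) (∈-positive⁺ {{∣⇒nonZero e∣n}} (∣⇒≤ e∣n)) e∣n

∈-divisors⁻ : ∀ {e n} → e ∈ divisors n → e ∣ n
∈-divisors⁻ {e} {n} e∈ = proj₂ (∈-filter⁻ (λ e → e ∣? n) {xs = map suc (upTo n)} e∈)

divisor≢0 : ∀ n {e} → e ∈ divisors n → NonZero e
divisor≢0 n e∈ = proj₁ (∈-positive⁻ (proj₁ (∈-filter⁻ (λ e → e ∣? n) {xs = map suc (upTo n)} e∈)))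

divisors-unique : ∀ n → Unique (divisors n)
divisors-unique n = Unique.filter⁺ (λ e → e ∣? n) (positive-unique n)

q*e-div-e : ∀ q e .{{_ : NonZero e}} → (q * e) div e ≡ q
q*e-div-e q (suc e) = m*n/n≡m q (suc e)

div-*-cancel : ∀ {e n} .{{_ : NonZero e}} → e ∣ n → (n div e) * e ≡ n
div-*-cancel {e} (divides q refl) = cong (_* e) (q*e-div-e q e)

-- Prime-power valuations

^-∣-^ : ∀ p {k v} → k ≤ v → p ^ k ∣ p ^ v
^-∣-^ p {k} {v} k≤v = subst (λ z → p ^ k ∣ p ^ z) (m+[n∸m]≡n k≤v)
  (subst (p ^ k ∣_) (sym (^-distribˡ-+-* p k (v ∸ k))) (m∣m*n (p ^ (v ∸ k))))

n<p^n : ∀ {p} → 1 < p → ∀ n → n < p ^ n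
n<p^n 1<p zero = ≤-refl
n<p^n {p} 1<p (suc n) = ≤-trans (s≤s (n<p^n 1<p n))
  (≤-trans (≤-reflexive (+-comm 1 (p ^ n))) (≤-trans (+-monoʳ-≤ (p ^ n) (≤-trans (s≤s z≤n) (n<p^n 1<p n)))
  (≤-trans (≤-reflexive (cong (p ^ n +_) (sym (+-identityʳ (p ^ n))))) (*-monoˡ-≤ (p ^ n) 1<p))))

_^_∥_ : ℕ → ℕ → ℕ → Set
p ^ v ∥ n = p ^ v ∣ n × ¬ p ^ suc v ∣ n

valuation : ∀ {p} → Prime p → ∀ n → .{{NonZero n}} → ∃ λ v → p ^ v ∥ n
valuation {p} prime-p = <-rec _ step
  where
  step : ∀ n → (∀ {m} → m < n → .{{NonZero m}} → ∃ λ v → p ^ v ∥ m) → .{{NonZero n}} → ∃ λ v → p ^ v ∥ n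
  step n rec with p ∣? n
  ... | no  p∤n = 0 , 1∣ n , λ p∣n → p∤n (subst (_∣ n) (*-identityʳ p) p∣n)
  ... | yes p∣n@(divides q refl) =
    let v , p^v∣q , p^v+1∤q = rec (quotient-< p∣n {{prime⇒nonTrivial prime-p}}) {{quotient≢0 p∣n}} in
    suc v , subst (p ^ suc v ∣_) (*-comm p q) (*-monoʳ-∣ p p^v∣q) ,
    λ h → p^v+1∤q (*-cancelˡ-∣ p {{prime⇒nonZero prime-p}} (subst (p ^ suc (suc v) ∣_) (*-comm q p) h))

-- The exponents counted by `expo` are exactly 1, ..., v: the cut-off at `n` loses none of them,
-- because v < p^v ≤ n.
expo≡valuation : ∀ {p v n} .{{_ : NonZero n}} → Prime p → p ^ v ∥ n → expo p n ≡ v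
expo≡valuation {p} {v} {n} prime-p (p^v∣n , p^v+1∤n) = trans
  (↭-length (unique-set⇒↭ (Unique.filter⁺ (λ k → p ^ k ∣? n) (positive-unique n)) (positive-unique v) to from))
  (trans (length-map suc (upTo v)) (length-upTo v))
  where
  to : ∀ {k} → k ∈ filter (λ k → p ^ k ∣? n) (map suc (upTo n)) → k ∈ map suc (upTo v)
  to {k} k∈ with ∈-filter⁻ (λ k → p ^ k ∣? n) {xs = map suc (upTo n)} k∈
  ... | k∈′ , p^k∣n = ∈-positive⁺ {{proj₁ (∈-positive⁻ k∈′)}}
    (≮⇒≥ λ v<k → p^v+1∤n (∣-trans (^-∣-^ p v<k) p^k∣n))
  v≤n : v ≤ n
  v≤n = ≤-trans (<⇒≤ (n<p^n {p} (nonTrivial⇒n>1 p {{prime⇒nonTrivial prime-p}}) v)) (∣⇒≤ p^v∣n)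
  from : ∀ {k} → k ∈ map suc (upTo v) → k ∈ filter (λ k → p ^ k ∣? n) (map suc (upTo n))
  from k∈ = let nz , k≤v = ∈-positive⁻ k∈ in
    ∈-filter⁺ (λ k → p ^ k ∣? n) (∈-positive⁺ {{nz}} (≤-trans k≤v v≤n)) (∣-trans (^-∣-^ p k≤v) p^v∣n)

∥-expo : ∀ {p n} .{{_ : NonZero n}} → Prime p → p ^ expo p n ∥ n
∥-expo {p} {n} prime-p with valuation prime-p n
... | v , v∥n = subst (λ z → p ^ z ∥ n) (sym (expo≡valuation {v = v} prime-p v∥n)) v∥n

-- Kernels of the reductions modulo e and sums over divisors

open Summation +-*-commutativeSemiring

-- Modulus 0, where congruence is equality, is included so that indicators can be written for every
-- `e` without an instance argument.
_≅?_⟨_⟩ : ∀ a b e → Dec (a ≅ b ⟨ e ⟩)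
a ≅? b ⟨ zero ⟩ = map′
  (λ a≡b → shifted 0 0 (cong (_+ 0) a≡b))
  (λ (shifted x y eq) → +-cancelʳ-≡ 0 a b
    (subst₂ (λ u w → a + u ≡ b + w) (*-zeroʳ x) (*-zeroʳ y) eq))
  (a ≟ b)
a ≅? b ⟨ e@(suc _) ⟩ = map′ %≡⇒≅ ≅⇒%≡ (a % e ≟ b % e)

≅-cancelˡ : ∀ {u a b e} .{{_ : NonZero e}} → Coprime u e → u * a ≅ u * b ⟨ e ⟩ → a ≅ b ⟨ e ⟩
≅-cancelˡ {u} {a} {b} {e} cop ua≅ub with inverse cop
... | w , uw≅1 , _ = ≅-trans (≅-sym (undo a)) (≅-trans (≅-* (≅-refl {w}) ua≅ub) (undo b))
  where
  ring : ∀ w u a → u * w * a ≡ w * (u * a)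
  ring = solve-∀
  undo : ∀ a → w * (u * a) ≅ a ⟨ e ⟩
  undo a = subst₂ (_≅_⟨ e ⟩) (ring w u a) (*-identityˡ a) (≅-* uw≅1 ≅-refl)

-- This translation serves twice: it identifies every fibre of the reduction with the kernel, and it
-- gives the invariance behind orthogonality.
unitShift : ∀ {u n} .{{_ : NonZero n}} → Coprime u n → BijectionOn (λ a → u * a % n) (units n) (units n)
unitShift {u} {n} cop = record
  { uniqueˡ    = units-unique n
  ; uniqueʳ    = units-unique n
  ; maps-to    = λ {a} a∈ → %-∈-units (Coprime-* {u} {a} cop (proj₂ (∈-units⁻ a∈)))
  ; injective  = λ x∈ y∈ eq → ≅∧<⇒≡ (proj₁ (∈-units⁻ x∈)) (proj₁ (∈-units⁻ y∈)) (≅-cancelˡ cop (%≡⇒≅ eq))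
  ; surjective = surj
  }
  where
  surj : ∀ {y} → y ∈ units n → ∃ λ x → x ∈ units n × y ≡ u * x % n
  surj {y} y∈ with inverse cop
  ... | w , uw≅1 , cop-w = w * y % n , %-∈-units (Coprime-* {w} {y} cop-w cop-y) ,
      trans (sym (m<n⇒m%n≡m y<n)) (≅⇒%≡ (≅-sym (≅-trans (≅-* (≅-refl {u}) (≅-% (w * y) n)) u[wy]≅y)))
    where
    y<n = proj₁ (∈-units⁻ y∈)
    cop-y = λ {d} → proj₂ (∈-units⁻ y∈) {d}
    u[wy]≅y : u * (w * y) ≅ y ⟨ n ⟩
    u[wy]≅y = subst₂ (_≅_⟨ n ⟩) (*-assoc u w y) (*-identityˡ y) (≅-* uw≅1 ≅-refl)

∑-const : {A : Set} (xs : List A) (c : ℕ) → ∑ xs (λ _ → c) ≡ length xs * c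
∑-const []       c = refl
∑-const (x ∷ xs) c = cong (c +_) (∑-const xs c)

-- The size of the kernel of the reduction from units modulo n to units modulo e.
kernelSize : ℕ → ℕ → ℕ
kernelSize n e = ∑ (units n) (λ a → 𝟙[ a ≅? 1 ⟨ e ⟩ ])

kernelSize[n,1]≡φ : ∀ n → kernelSize n 1 ≡ φ n
kernelSize[n,1]≡φ n = trans
  (∑-cong (units n) λ {a} _ → 𝟙-true (a ≅? 1 ⟨ 1 ⟩) (shifted 1 a (trans (+-comm a 1) (cong suc (sym (*-identityʳ a))))))
  (trans (∑-const (units n) 1) (*-identityʳ _))

-- A lift of `b` to a unit modulo `n` exists by `unit-lift`, and multiplication by it carries the
-- kernel onto the fibre over `b`.
fibreSize : ∀ {b n e} .{{_ : NonZero n}} .{{_ : NonZero e}} → e ∣ n → Coprime b e →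
  ∑ (units n) (λ a → 𝟙[ a ≅? b ⟨ e ⟩ ]) ≡ kernelSize n e
fibreSize {b} {n} {e} e∣n cop with unit-lift n cop
... | u , u≅b , cop-u = trans
  (sym (∑-reindex (unitShift cop-u) (λ a → 𝟙[ a ≅? b ⟨ e ⟩ ])))
  (∑-cong (units n) λ {a} _ → 𝟙-cong ((u * a % n) ≅? b ⟨ e ⟩) (a ≅? 1 ⟨ e ⟩) (to a) (from a))
  where
  reduce : ∀ a → u * a % n ≅ u * a ⟨ e ⟩
  reduce a = ≅-coarsen e∣n (≅-% (u * a) n)
  u*1≅b : u * 1 ≅ b ⟨ e ⟩
  u*1≅b = subst (_≅ b ⟨ e ⟩) (sym (*-identityʳ u)) u≅b
  to : ∀ a → u * a % n ≅ b ⟨ e ⟩ → a ≅ 1 ⟨ e ⟩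
  to a h = ≅-cancelˡ (Coprime-∣ ∣-refl e∣n cop-u) (≅-trans (≅-sym (reduce a)) (≅-trans h (≅-sym u*1≅b)))
  from : ∀ a → a ≅ 1 ⟨ e ⟩ → u * a % n ≅ b ⟨ e ⟩
  from a h = ≅-trans (reduce a) (≅-trans (≅-* (≅-refl {u}) h) u*1≅b)

-- The units modulo `n` are counted by their residues modulo `e`, which are units there, and all
-- fibres have the size of the kernel.
φ*kernelSize : ∀ {n e} .{{_ : NonZero n}} → e ∣ n → φ e * kernelSize n e ≡ φ n
φ*kernelSize {n} {e} e∣n = sym (begin
  φ n
    ≡⟨ sym (trans (∑-const (units n) 1) (*-identityʳ _)) ⟩
  ∑ (units n) (λ _ → 1)
    ≡⟨ ∑-cong (units n) (λ {a} a∈ → sym (∑-delta (λ b → a ≅? b ⟨ e ⟩) (units-unique e)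
         (%-∈-units (Coprime-∣ ∣-refl e∣n (proj₂ (∈-units⁻ a∈)))) (≅-sym (≅-% a e))
         (λ b∈ a≅b → ≅∧<⇒≡ (proj₁ (∈-units⁻ b∈)) (m%n<n a e) (≅-trans (≅-sym a≅b) (≅-sym (≅-% a e))))
         (λ _ → 1))) ⟩
  ∑ (units n) (λ a → ∑ (units e) (λ b → 𝟙[ a ≅? b ⟨ e ⟩ ] * 1))
    ≡⟨ ∑-swap (units n) (units e) _ ⟩
  ∑ (units e) (λ b → ∑ (units n) (λ a → 𝟙[ a ≅? b ⟨ e ⟩ ] * 1))
    ≡⟨ ∑-cong (units e) (λ {b} b∈ → trans (∑-cong (units n) λ _ → *-identityʳ _) (fibreSize e∣n (proj₂ (∈-units⁻ b∈)))) ⟩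
  ∑ (units e) (λ _ → kernelSize n e)
    ≡⟨ ∑-const (units e) (kernelSize n e) ⟩
  φ e * kernelSize n e ∎)
  where
  open ≡-Reasoning
  instance _ = ∣⇒nonZero e∣n

-- The residues a below e * q with gcd(a, e * q) = q are the multiples q * b with b coprime to e.
gcdFibre : ∀ {e q} .{{_ : NonZero e}} .{{_ : NonZero q}} →
  BijectionOn (q *_) (units e) (filter (λ a → e * gcd a (e * q) ≟ e * q) (upTo (e * q)))
gcdFibre {e} {q} = record
  { uniqueˡ    = units-unique e
  ; uniqueʳ    = Unique.filter⁺ P? (Unique.upTo⁺ (e * q))
  ; maps-to    = λ b∈ → let b<e , cop = ∈-units⁻ b∈ in
      ∈-filter⁺ P? (∈-upTo⁺ (subst (_< e * q) (*-comm _ q) (*-monoˡ-< q b<e)))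
        (cong (e *_) (trans (gcd[q*b] _) (trans (cong (q *_) (Coprimality.coprime⇒gcd≡1 cop)) (*-identityʳ q))))
  ; injective  = λ _ _ → *-cancelˡ-≡ _ _ q
  ; surjective = surj
  }
  where
  P? = λ a → e * gcd a (e * q) ≟ e * q
  gcd[q*b] : ∀ b → gcd (q * b) (e * q) ≡ q * gcd b e
  gcd[q*b] b = trans (cong (gcd (q * b)) (*-comm e q)) (sym (GCD.c*gcd[m,n]≡gcd[cm,cn] q b e))
  surj : ∀ {a} → a ∈ filter P? (upTo (e * q)) → ∃ λ b → b ∈ units e × a ≡ q * b
  surj {a} a∈ with ∈-filter⁻ P? {xs = upTo (e * q)} a∈
  ... | a∈upTo , eq with *-cancelˡ-≡ (gcd a (e * q)) q e eq
  ...   | g≡q with subst (_∣ a) g≡q (gcd[m,n]∣m a (e * q))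
  ...     | divides b refl = b , ∈-units⁺ (*-cancelʳ-< q b e (∈-upTo⁻ a∈upTo))
      (Coprimality.gcd≡1⇒coprime (*-cancelˡ-≡ (gcd b e) 1 q (trans (sym (gcd[q*b] b))
        (trans (cong (λ z → gcd z (e * q)) (*-comm q b)) (trans g≡q (sym (*-identityʳ q))))))) , *-comm b q

-- Gauss's count: the residues modulo `n` are sorted by e = n / gcd(a, n), a relation written as
-- `e * gcd a n ≡ n` to avoid division.
∑φ : ∀ n → .{{NonZero n}} → ∑ (divisors n) φ ≡ n
∑φ n = sym (begin
  n ≡⟨ sym (trans (∑-const (upTo n) 1) (trans (*-identityʳ _) (length-upTo n))) ⟩
  ∑ (upTo n) (λ _ → 1)
    ≡⟨ ∑-cong (upTo n) (λ {a} _ → sym (∑-delta (λ e → e * gcd a n ≟ n) (divisors-unique n)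
         (∈-divisors⁺ (quotient-∣ (gcd[m,n]∣n a n))) (sym (m∣n⇒n≡quotient*m (gcd[m,n]∣n a n)))
         (λ {e} _ eq → *-cancelʳ-≡ e _ (gcd a n) {{∣⇒nonZero (gcd[m,n]∣n a n)}}
            (trans eq (m∣n⇒n≡quotient*m (gcd[m,n]∣n a n))))
         (λ _ → 1))) ⟩
  ∑ (upTo n) (λ a → ∑ (divisors n) (λ e → 𝟙[ e * gcd a n ≟ n ] * 1))
    ≡⟨ ∑-swap (upTo n) (divisors n) _ ⟩
  ∑ (divisors n) (λ e → ∑ (upTo n) (λ a → 𝟙[ e * gcd a n ≟ n ] * 1))
    ≡⟨ ∑-cong (divisors n) (λ e∈ → fibre (divisor≢0 n e∈) (∈-divisors⁻ e∈)) ⟩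
  ∑ (divisors n) φ ∎)
  where
  open ≡-Reasoning
  fibre : ∀ {e} → NonZero e → e ∣ n → ∑ (upTo n) (λ a → 𝟙[ e * gcd a n ≟ n ] * 1) ≡ φ e
  fibre {e} e≢0 e∣n@(divides q n≡q*e) with trans n≡q*e (*-comm q e)
  ... | refl = begin
    ∑ (upTo n) (λ a → 𝟙[ e * gcd a n ≟ n ] * 1)      ≡⟨ sym (∑-filter (λ a → e * gcd a n ≟ n) (upTo n) (λ _ → 1)) ⟩
    ∑ (filter (λ a → e * gcd a n ≟ n) (upTo n)) (λ _ → 1)
      ≡⟨ sym (∑-reindex (gcdFibre {{e≢0}} {{quotient≢0 e∣n}}) (λ _ → 1)) ⟩
    ∑ (units e) (λ _ → 1)                            ≡⟨ trans (∑-const (units e) 1) (*-identityʳ _) ⟩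
    φ e                                              ∎

-- Summing over the divisors of `n` instead of those of `g` keeps the range independent of the tuple
-- that produces `g`, as the exchange of sums requires.
∑φ-common : ∀ {g n} .{{_ : NonZero n}} → g ∣ n → ∑ (divisors n) (λ e → 𝟙[ e ∣? g ] * φ e) ≡ g
∑φ-common {g} {n} g∣n = trans (sym (∑-filter (_∣? g) (divisors n) φ)) (trans (∑-↭ φ (unique-set⇒↭
    (Unique.filter⁺ (_∣? g) (divisors-unique n)) (divisors-unique g)
    (λ e∈ → ∈-divisors⁺ (proj₂ (∈-filter⁻ (_∣? g) {xs = divisors n} e∈)))
    (λ e∈ → ∈-filter⁺ (_∣? g) (∈-divisors⁺ (∣-trans (∈-divisors⁻ e∈) g∣n)) (∈-divisors⁻ e∈))))
  (∑φ g))
  where instance _ = ∣⇒nonZero g∣n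

-- Kernel sizes: multiplicativity and the case of full residue classes

residuePairs : ∀ {m n} .{{_ : NonZero m}} .{{_ : NonZero n}} → Coprime m n →
  BijectionOn (λ x → x % m , x % n) (units (m * n)) (cartesianProduct (units m) (units n))
residuePairs {m} {n} cop = record
  { uniqueˡ    = units-unique (m * n)
  ; uniqueʳ    = Unique.cartesianProduct⁺ (units-unique m) (units-unique n)
  ; maps-to    = λ x∈ → ∈-cartesianProduct⁺
      (%-∈-units (Coprime-∣ ∣-refl (m∣m*n n) (proj₂ (∈-units⁻ x∈))))
      (%-∈-units (Coprime-∣ ∣-refl (n∣m*n m) (proj₂ (∈-units⁻ x∈))))
  ; injective  = λ x∈ y∈ eq → ≅∧<⇒≡ (proj₁ (∈-units⁻ x∈)) (proj₁ (∈-units⁻ y∈))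
      (≅-combine cop (%≡⇒≅ (cong proj₁ eq)) (%≡⇒≅ (cong proj₂ eq)))
  ; surjective = surj
  }
  where
  instance _ = m*n≢0 m n
  surj : ∀ {z} → z ∈ cartesianProduct (units m) (units n) →
    ∃ λ x → x ∈ units (m * n) × z ≡ (x % m , x % n)
  surj {a , b} z∈ with ∈-cartesianProduct⁻ (units m) (units n) z∈
  ... | a∈ , b∈ with chineseRemainder cop a b
  ...   | x , x≅a , x≅b = x % (m * n) , %-∈-units (Coprimality.sym (Coprime-* {m} {n}
            (Coprimality.sym (Coprime-resp-≅ x≅a (proj₂ (∈-units⁻ a∈))))
            (Coprimality.sym (Coprime-resp-≅ x≅b (proj₂ (∈-units⁻ b∈)))))) ,
          cong₂ _,_ (residue (m∣m*n n) (proj₁ (∈-units⁻ a∈)) x≅a) (residue (n∣m*n m) (proj₁ (∈-units⁻ b∈)) x≅b)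
    where
    residue : ∀ {a k} .{{_ : NonZero k}} → k ∣ m * n → a < k → x ≅ a ⟨ k ⟩ → a ≡ x % (m * n) % k
    residue k∣mn a<k x≅a = trans (sym (m<n⇒m%n≡m a<k))
      (≅⇒%≡ (≅-sym (≅-trans (≅-coarsen k∣mn (≅-% x (m * n))) x≅a)))

-- Being 1 modulo `e * f` splits into being 1 modulo `e` and modulo `f`. Each condition depends on
-- only one coordinate of the pair of residues, so the count is a product.
kernelSize-* : ∀ {m n e f} .{{_ : NonZero m}} .{{_ : NonZero n}} → Coprime m n → e ∣ m → f ∣ n →
  kernelSize (m * n) (e * f) ≡ kernelSize m e * kernelSize n f
kernelSize-* {m} {n} {e} {f} cop e∣m f∣n = begin
  ∑ (units (m * n)) (λ x → 𝟙[ x ≅? 1 ⟨ e * f ⟩ ])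
    ≡⟨ ∑-cong (units (m * n)) (λ {x} _ → 𝟙-× (x ≅? 1 ⟨ e * f ⟩) ((x % m) ≅? 1 ⟨ e ⟩) ((x % n) ≅? 1 ⟨ f ⟩)
         (λ h → ≅-trans (reduce x e∣m) (≅-coarsen (m∣m*n f) h))
         (λ h → ≅-trans (reduce x f∣n) (≅-coarsen (n∣m*n e) h))
         (λ h h′ → ≅-combine (Coprime-∣ e∣m f∣n cop)
           (≅-trans (≅-sym (reduce x e∣m)) h) (≅-trans (≅-sym (reduce x f∣n)) h′))) ⟩
  ∑ (units (m * n)) (λ x → 𝟙[ (x % m) ≅? 1 ⟨ e ⟩ ] * 𝟙[ (x % n) ≅? 1 ⟨ f ⟩ ])
    ≡⟨ ∑-reindex (residuePairs cop) (λ z → 𝟙[ proj₁ z ≅? 1 ⟨ e ⟩ ] * 𝟙[ proj₂ z ≅? 1 ⟨ f ⟩ ]) ⟩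
  ∑ (cartesianProduct (units m) (units n)) (λ z → 𝟙[ proj₁ z ≅? 1 ⟨ e ⟩ ] * 𝟙[ proj₂ z ≅? 1 ⟨ f ⟩ ])
    ≡⟨ ∑-cartesianProduct (units m) (units n) (λ a b → 𝟙[ a ≅? 1 ⟨ e ⟩ ] * 𝟙[ b ≅? 1 ⟨ f ⟩ ]) ⟩
  ∑ (units m) (λ a → ∑ (units n) (λ b → 𝟙[ a ≅? 1 ⟨ e ⟩ ] * 𝟙[ b ≅? 1 ⟨ f ⟩ ]))
    ≡⟨ ∑-product (units m) (units n) _ _ ⟩
  kernelSize m e * kernelSize n f ∎
  where
  open ≡-Reasoning
  reduce : ∀ x {k d} .{{_ : NonZero k}} → d ∣ k → x % k ≅ x ⟨ d ⟩
  reduce x {k} d∣k = ≅-coarsen d∣k (≅-% x k)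

residueClass : ∀ q b {e} .{{_ : NonZero e}} →
  BijectionOn (λ i → b % e + i * e) (upTo q) (filter (λ a → a ≅? b ⟨ e ⟩) (upTo (q * e)))
residueClass q b {e} = record
  { uniqueˡ    = Unique.upTo⁺ q
  ; uniqueʳ    = Unique.filter⁺ P? (Unique.upTo⁺ (q * e))
  ; maps-to    = λ {i} i∈ → ∈-filter⁺ P?
      (∈-upTo⁺ (≤-trans (+-monoˡ-< (i * e) (m%n<n b e)) (*-monoˡ-≤ e (∈-upTo⁻ i∈))))
      (≅-trans (≅-+multiple (b % e) i e) (≅-% b e))
  ; injective  = λ {i} {j} _ _ eq → *-cancelʳ-≡ i j e (+-cancelˡ-≡ (b % e) _ _ eq)
  ; surjective = surj
  }
  where
  P? = λ a → a ≅? b ⟨ e ⟩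
  surj : ∀ {a} → a ∈ filter P? (upTo (q * e)) → ∃ λ i → i ∈ upTo q × a ≡ b % e + i * e
  surj {a} a∈ with ∈-filter⁻ P? {xs = upTo (q * e)} a∈
  ... | a∈upTo , a≅b = a / e ,
    ∈-upTo⁺ (*-cancelʳ-< e (a / e) q (≤-<-trans
      (subst (a / e * e ≤_) (sym (m≡m%n+[m/n]*n a e)) (m≤n+m (a / e * e) (a % e))) (∈-upTo⁻ a∈upTo))) ,
    trans (m≡m%n+[m/n]*n a e) (cong (_+ a / e * e) (≅⇒%≡ a≅b))

residueClassSize : ∀ {n e} b .{{_ : NonZero e}} → e ∣ n → ∑ (upTo n) (λ a → 𝟙[ a ≅? b ⟨ e ⟩ ]) ≡ n div e
residueClassSize {e = e} b (divides q refl) = begin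
  ∑ (upTo (q * e)) (λ a → 𝟙[ a ≅? b ⟨ e ⟩ ])     ≡⟨ ∑-cong (upTo (q * e)) (λ _ → sym (*-identityʳ _)) ⟩
  ∑ (upTo (q * e)) (λ a → 𝟙[ a ≅? b ⟨ e ⟩ ] * 1) ≡⟨ sym (∑-filter (λ a → a ≅? b ⟨ e ⟩) (upTo (q * e)) (λ _ → 1)) ⟩
  ∑ (filter (λ a → a ≅? b ⟨ e ⟩) (upTo (q * e))) (λ _ → 1) ≡⟨ sym (∑-reindex (residueClass q b) (λ _ → 1)) ⟩
  ∑ (upTo q) (λ _ → 1)                           ≡⟨ trans (∑-const (upTo q) 1) (trans (*-identityʳ _) (length-upTo q)) ⟩
  q                                              ≡⟨ sym (q*e-div-e q e) ⟩
  (q * e) div e                                  ∎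
  where open ≡-Reasoning

multiplesBelow : ∀ {n e} .{{_ : NonZero e}} → e ∣ n → ∑ (upTo n) (λ a → 𝟙[ e ∣? a ]) ≡ n div e
multiplesBelow {n} {e} e∣n = trans
  (∑-cong (upTo n) λ {a} _ → 𝟙-cong (e ∣? a) (a ≅? 0 ⟨ e ⟩) ∣⇒≅ (λ a≅0 → ∣-resp-≅ ∣-refl a≅0 (e ∣0)))
  (residueClassSize 0 e∣n)

-- A number that is 1 modulo `e` has no prime in common with `e`, hence none with `n`. Coprimality
-- to `n` is thus automatic, and the kernel is the whole class of 1 modulo `e`.
kernelSize≡div : ∀ {n e} .{{_ : NonZero n}} → e ∣ n → (∀ p → Prime p → p ∣ n → p ∣ e) → kernelSize n e ≡ n div e
kernelSize≡div {n} {e} e∣n primes = trans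
  (∑-filter (λ a → coprime? a n) (upTo n) _)
  (trans (∑-cong (upTo n) λ {a} _ →
      sym (𝟙-× (a ≅? 1 ⟨ e ⟩) (coprime? a n) (a ≅? 1 ⟨ e ⟩) (λ a≅1 {d} → coprime a≅1 {d}) id (λ _ → id)))
    (residueClassSize 1 {{∣⇒nonZero e∣n}} e∣n))
  where
  coprime : ∀ {a} → a ≅ 1 ⟨ e ⟩ → Coprime a n
  coprime a≅1 = no-common-prime⇒coprime λ p prime-p p∣a p∣n →
    prime≢1 prime-p (∣1⇒≡1 (∣-resp-≅ (primes p prime-p p∣n) (≅-sym a≅1) p∣a))

-- Divisors of coprime products and complementary divisors

divisorPairs : ∀ {m n} .{{_ : NonZero m}} .{{_ : NonZero n}} → Coprime m n →
  BijectionOn (λ z → proj₁ z * proj₂ z) (cartesianProduct (divisors m) (divisors n)) (divisors (m * n))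
divisorPairs {m} {n} cop = record
  { uniqueˡ    = Unique.cartesianProduct⁺ (divisors-unique m) (divisors-unique n)
  ; uniqueʳ    = divisors-unique (m * n)
  ; maps-to    = λ z∈ → let e∈ , f∈ = ∈-cartesianProduct⁻ (divisors m) (divisors n) z∈ in
      ∈-divisors⁺ (*-pres-∣ {m = m} {n = n} (∈-divisors⁻ e∈) (∈-divisors⁻ f∈))
  ; injective  = inj
  ; surjective = surj
  }
  where
  instance _ = m*n≢0 m n
  first-∣ : ∀ {e f e′ f′} → e ∣ m → f′ ∣ n → e * f ≡ e′ * f′ → e ∣ e′
  first-∣ {e} {f} {e′} {f′} e∣m f′∣n eq =
    coprime-divisor (Coprime-∣ e∣m f′∣n cop) (subst (e ∣_) (trans eq (*-comm e′ f′)) (m∣m*n f))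
  inj : ∀ {z w} → z ∈ cartesianProduct (divisors m) (divisors n) → w ∈ cartesianProduct (divisors m) (divisors n) →
    proj₁ z * proj₂ z ≡ proj₁ w * proj₂ w → z ≡ w
  inj {e , f} {e′ , f′} z∈ w∈ eq
    with ∈-cartesianProduct⁻ (divisors m) (divisors n) z∈ | ∈-cartesianProduct⁻ (divisors m) (divisors n) w∈
  ... | e∈ , f∈ | e′∈ , f′∈
    with ∣-antisym (first-∣ (∈-divisors⁻ e∈) (∈-divisors⁻ f′∈) eq)
                   (first-∣ (∈-divisors⁻ e′∈) (∈-divisors⁻ f∈) (sym eq))
  ... | refl = cong (e ,_) (*-cancelˡ-≡ f f′ e {{divisor≢0 m e∈}} eq)
  surj : ∀ {h} → h ∈ divisors (m * n) →
    ∃ λ z → z ∈ cartesianProduct (divisors m) (divisors n) × h ≡ proj₁ z * proj₂ z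
  -- The part of `h` inside `m` is g = gcd(h, m). Since no larger common divisor exists, f = h/g is
  -- coprime to m/g; it divides (m/g) n and therefore `n`.
  surj {h} h∈ with gcd[m,n]∣m h m | gcd[m,n]∣n h m
  ... | g∣h@(divides f h≡f*g) | g∣m@(divides m′ m≡m′*g) =
    (g , f) , ∈-cartesianProduct⁺ (∈-divisors⁺ g∣m) (∈-divisors⁺ f∣n) , trans h≡f*g (*-comm f g)
    where
    g = gcd h m
    instance
      g≢0 : NonZero g
      g≢0 = ∣⇒nonZero g∣m
    f⊥m′ : Coprime f m′
    f⊥m′ {d} (d∣f , d∣m′) = *-cancelʳ-≡ d 1 g (trans (∣-antisym
      (gcd-greatest (subst (d * g ∣_) (sym h≡f*g) (*-monoˡ-∣ g d∣f)) (subst (d * g ∣_) (sym m≡m′*g) (*-monoˡ-∣ g d∣m′)))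
      (n∣m*n d)) (sym (*-identityˡ g)))
    ring : ∀ m′ g n → m′ * g * n ≡ m′ * n * g
    ring = solve-∀
    f∣n : f ∣ n
    f∣n = coprime-divisor f⊥m′ (*-cancelʳ-∣ g
      (subst₂ _∣_ h≡f*g (trans (cong (_* n) m≡m′*g) (ring m′ g n)) (∈-divisors⁻ h∈)))

∑-divisors-* : ∀ {m n} .{{_ : NonZero m}} .{{_ : NonZero n}} → Coprime m n → (F : ℕ → ℕ) →
  ∑ (divisors (m * n)) F ≡ ∑ (divisors m) (λ e → ∑ (divisors n) (λ f → F (e * f)))
∑-divisors-* {m} {n} cop F = trans (sym (∑-reindex (divisorPairs cop) F))
  (∑-cartesianProduct (divisors m) (divisors n) (λ e f → F (e * f)))

div-* : ∀ {m n e f} .{{_ : NonZero e}} .{{_ : NonZero f}} → e ∣ m → f ∣ n →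
  (m * n) div (e * f) ≡ (m div e) * (n div f)
div-* {e = e} {f} (divides q refl) (divides q′ refl) = trans
  (cong (_div (e * f)) (ring q e q′ f))
  (trans (q*e-div-e (q * q′) (e * f) {{m*n≢0 e f}}) (sym (cong₂ _*_ (q*e-div-e q e) (q*e-div-e q′ f))))
  where
  ring : ∀ q e q′ f → q * e * (q′ * f) ≡ q * q′ * (e * f)
  ring = solve-∀

div-∣ : ∀ {e n} .{{_ : NonZero e}} → e ∣ n → (n div e) ∣ n
div-∣ {e} e∣n = divides e (trans (sym (div-*-cancel e∣n)) (*-comm _ e))

div-div : ∀ {e n} .{{_ : NonZero e}} .{{_ : NonZero n}} → e ∣ n → n div (n div e) ≡ e
div-div {e} {n} e∣n = trans
  (cong (_div (n div e)) (trans (sym (div-*-cancel e∣n)) (*-comm _ e)))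
  (q*e-div-e e (n div e) {{∣⇒nonZero (div-∣ e∣n)}})

-- The divisors of n that are multiples of d are n / f for f dividing n / d.
complementaryDivisor : ∀ {d n} .{{_ : NonZero n}} → d ∣ n →
  BijectionOn (n div_) (divisors (n div d)) (filter (d ∣?_) (divisors n))
complementaryDivisor {d} {n} d∣n = record
  { uniqueˡ    = divisors-unique (n div d)
  ; uniqueʳ    = Unique.filter⁺ (d ∣?_) (divisors-unique n)
  ; maps-to    = λ f∈ → ∈-filter⁺ (d ∣?_) (∈-divisors⁺ (div-∣ {{divisor≢0 (n div d) f∈}} (f∣n f∈))) (d∣n/f f∈)
  ; injective  = λ x∈ y∈ eq → trans (sym (div-div {{divisor≢0 (n div d) x∈}} (f∣n x∈)))
      (trans (cong (n div_) eq) (div-div {{divisor≢0 (n div d) y∈}} (f∣n y∈)))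
  ; surjective = surj
  }
  where
  instance
    d≢0 : NonZero d
    d≢0 = ∣⇒nonZero d∣n
  n/d∣n = div-∣ d∣n
  instance
    n/d≢0 : NonZero (n div d)
    n/d≢0 = ∣⇒nonZero n/d∣n
  f∣n : ∀ {f} → f ∈ divisors (n div d) → f ∣ n
  f∣n f∈ = ∣-trans (∈-divisors⁻ f∈) n/d∣n
  d∣n/f : ∀ {f} → f ∈ divisors (n div d) → d ∣ n div f
  d∣n/f {f} f∈ with ∈-divisors⁻ {n = n div d} f∈
  ... | divides q n/d≡q*f = divides q (trans
    (cong (_div f) (trans (sym (div-*-cancel d∣n)) (trans (cong (_* d) n/d≡q*f) (ring q f d))))
    (q*e-div-e (q * d) f {{divisor≢0 (n div d) f∈}}))
    where
    ring : ∀ q f d → q * f * d ≡ q * d * f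
    ring = solve-∀
  surj : ∀ {e} → e ∈ filter (d ∣?_) (divisors n) → ∃ λ f → f ∈ divisors (n div d) × e ≡ n div f
  surj {e} e∈ with ∈-filter⁻ (d ∣?_) {xs = divisors n} e∈
  ... | e∈D , divides q e≡q*d with divisor≢0 n e∈D | ∈-divisors⁻ e∈D
  ...   | e≢0 | e∣n = n div e , ∈-divisors⁺ (divides q (*-cancelʳ-≡ (n div d) (q * (n div e)) d
      (trans (div-*-cancel d∣n) (trans (sym (div-*-cancel {{e≢0}} e∣n))
        (trans (cong ((n div e) *_) e≡q*d) (ring (n div e) q d)))))) , sym (div-div {{e≢0}} e∣n)
    where
    ring : ∀ t q d → t * (q * d) ≡ q * t * d
    ring = solve-∀

-- Both kinds of σ in the formula arise here: the global one from the lcm of the conductors, the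
-- local ones from `d` = 1.
∑-complementary≡σ : ∀ {d n} k .{{_ : NonZero n}} → d ∣ n →
  ∑ (divisors n) (λ e → 𝟙[ d ∣? e ] * (n div e) ^ k) ≡ σ k (n div d)
∑-complementary≡σ {d} {n} k d∣n = begin
  ∑ (divisors n) (λ e → 𝟙[ d ∣? e ] * (n div e) ^ k)
    ≡⟨ sym (∑-filter (d ∣?_) (divisors n) (λ e → (n div e) ^ k)) ⟩
  ∑ (filter (d ∣?_) (divisors n)) (λ e → (n div e) ^ k)
    ≡⟨ sym (∑-reindex (complementaryDivisor d∣n) (λ e → (n div e) ^ k)) ⟩
  ∑ (divisors (n div d)) (λ f → (n div (n div f)) ^ k)
    ≡⟨ ∑-cong (divisors (n div d)) (λ f∈ → cong (_^ k) (div-div {{divisor≢0 (n div d) f∈}}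
         (∣-trans (∈-divisors⁻ f∈) (div-∣ {{∣⇒nonZero d∣n}} d∣n)))) ⟩
  σ k (n div d) ∎
  where open ≡-Reasoning

-- Divisor sums weighted by kernel sizes

^-distribʳ-* : ∀ k a b → (a * b) ^ k ≡ a ^ k * b ^ k
^-distribʳ-* zero    a b = refl
^-distribʳ-* (suc k) a b = trans (cong (a * b *_) (^-distribʳ-* k a b)) (ring a b (a ^ k) (b ^ k))
  where
  ring : ∀ a b c d → a * b * (c * d) ≡ a * c * (b * d)
  ring = solve-∀

-- The inner sum without a condition on `e`, that is, for trivial characters. Here and in the lemmas
-- about it, `s` is the exponent s - 1 of the theorem.
kernelSum : ℕ → ℕ → ℕ → ℕ
kernelSum s r n = ∑ (divisors n) (λ e → kernelSize n e ^ s * (n div e) ^ r)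

kernelTerm-* : ∀ s r {m n e f} .{{_ : NonZero m}} .{{_ : NonZero n}} → Coprime m n → e ∣ m → f ∣ n →
  kernelSize (m * n) (e * f) ^ s * ((m * n) div (e * f)) ^ r ≡
  (kernelSize m e ^ s * (m div e) ^ r) * (kernelSize n f ^ s * (n div f) ^ r)
kernelTerm-* s r {m} {n} {e} {f} cop e∣m f∣n = trans
  (cong₂ _*_
    (trans (cong (_^ s) (kernelSize-* cop e∣m f∣n)) (^-distribʳ-* s _ _))
    (trans (cong (_^ r) (div-* {{∣⇒nonZero e∣m}} {{∣⇒nonZero f∣n}} e∣m f∣n)) (^-distribʳ-* r _ _)))
  (ring (kernelSize m e ^ s) _ _ _)
  where
  ring : ∀ a b c d → (a * b) * (c * d) ≡ (a * c) * (b * d)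
  ring = solve-∀

kernelSum-* : ∀ s r {m n} .{{_ : NonZero m}} .{{_ : NonZero n}} → Coprime m n →
  kernelSum s r (m * n) ≡ kernelSum s r m * kernelSum s r n
kernelSum-* s r {m} {n} cop = trans (∑-divisors-* cop _) (trans
  (∑-cong (divisors m) λ e∈ → ∑-cong (divisors n) λ f∈ →
    kernelTerm-* s r cop (∈-divisors⁻ e∈) (∈-divisors⁻ f∈))
  (∑-product (divisors m) (divisors n) _ _))

kernelSum-1 : ∀ s r → kernelSum s r 1 ≡ 1
kernelSum-1 s r = trans (+-identityʳ _) (cong₂ _*_ (^-zeroˡ s) (^-zeroˡ r))

-- A divisor of `p ^ m` not divisible by `p` is coprime to `p ^ m` and so equals 1. The remaining
-- divisors are kept with the indicator of `p ∣ e`, which is the hypothesis needed to evaluate their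
-- kernels.
∑-divisors-prime^ : ∀ {p} m → Prime p → (F : ℕ → ℕ) →
  ∑ (divisors (p ^ m)) F ≡ F 1 + ∑ (divisors (p ^ m)) (λ e → 𝟙[ p ∣? e ] * F e)
∑-divisors-prime^ {p} m prime-p F = begin
  ∑ D F
    ≡⟨ ∑-cong D (λ {e} e∈ → trans (sym (*-identityˡ (F e)))
         (trans (cong (_* F e) (sym (dichotomy e e∈))) (*-distribʳ-+ (F e) 𝟙[ e ≟ 1 ] 𝟙[ p ∣? e ]))) ⟩
  ∑ D (λ e → 𝟙[ e ≟ 1 ] * F e + 𝟙[ p ∣? e ] * F e)
    ≡⟨ ∑-⊕ D _ _ ⟩
  ∑ D (λ e → 𝟙[ e ≟ 1 ] * F e) + ∑ D (λ e → 𝟙[ p ∣? e ] * F e)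
    ≡⟨ cong₂ _+_ (∑-delta (_≟ 1) (divisors-unique (p ^ m)) (∈-divisors⁺ (1∣ (p ^ m))) refl (λ _ → id) F) refl ⟩
  F 1 + ∑ D (λ e → 𝟙[ p ∣? e ] * F e) ∎
  where
  open ≡-Reasoning
  D = divisors (p ^ m)
  instance
    p^m≢0 : NonZero (p ^ m)
    p^m≢0 = m^n≢0 p m {{prime⇒nonZero prime-p}}
  dichotomy : ∀ e → e ∈ D → 𝟙[ e ≟ 1 ] + 𝟙[ p ∣? e ] ≡ 1
  dichotomy e e∈ with p ∣? e
  ... | yes p∣e = cong (_+ 1) (𝟙-false (e ≟ 1) λ { refl → prime≢1 prime-p (∣1⇒≡1 p∣e) })
  ... | no  p∤e = cong (_+ 0) (𝟙-true (e ≟ 1)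
    (Coprime-^ m (prime∤⇒coprime prime-p p∤e) (∈-divisors⁻ e∈ , ∣-refl)))

-- Both `kernelSum` and σ share the part `W` over the divisors divisible by `p`. The truncated
-- subtraction is exact because the number subtracted is itself the summand of σ outside `W`.
kernelSum-prime^ : ∀ s r {p} m → Prime p →
  kernelSum s r (p ^ m) ≡ φ (p ^ m) ^ s * p ^ (m * r) + σ (s + r) (p ^ m) ∸ p ^ (m * (s + r))
kernelSum-prime^ s r {p} m prime-p = sym (begin
  Φ + σ (s + r) q ∸ p ^ (m * (s + r))
    ≡⟨ cong₂ (λ x y → Φ + x ∸ y) σ-split (sym (^-*-assoc p m (s + r))) ⟩
  Φ + (q ^ (s + r) + W) ∸ q ^ (s + r)
    ≡⟨ cong (_∸ q ^ (s + r)) (ring Φ (q ^ (s + r)) W) ⟩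
  Φ + W + q ^ (s + r) ∸ q ^ (s + r)
    ≡⟨ m+n∸n≡m (Φ + W) (q ^ (s + r)) ⟩
  Φ + W
    ≡⟨ sym kernelSum-split ⟩
  kernelSum s r q ∎)
  where
  open ≡-Reasoning
  q = p ^ m
  Φ = φ q ^ s * p ^ (m * r)
  W = ∑ (divisors q) (λ e → 𝟙[ p ∣? e ] * (q div e) ^ (s + r))
  instance
    q≢0 : NonZero q
    q≢0 = m^n≢0 p m {{prime⇒nonZero prime-p}}
  div-1 : ∀ n → n div 1 ≡ n
  div-1 n = trans (cong (_div 1) (sym (*-identityʳ n))) (q*e-div-e n 1)
  ring : ∀ a b c → a + (b + c) ≡ a + c + b
  ring = solve-∀
  σ-split : σ (s + r) q ≡ q ^ (s + r) + W
  σ-split = trans (cong (σ (s + r)) (sym (div-1 q))) (trans (sym (∑-complementary≡σ (s + r) (1∣ q))) (trans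
    (∑-cong (divisors q) λ {e} _ → trans (cong (_* (q div e) ^ (s + r)) (𝟙-true (1 ∣? e) (1∣ e))) (*-identityˡ _))
    (trans (∑-divisors-prime^ m prime-p (λ e → (q div e) ^ (s + r))) (cong (λ z → z ^ (s + r) + W) (div-1 q)))))
  p-only : ∀ k → ∀ {p′} → Prime p′ → p′ ∣ p ^ k → p′ ≡ p
  p-only zero    prime-p′ p′∣1 = ⊥-elim (prime≢1 prime-p′ (∣1⇒≡1 p′∣1))
  p-only (suc k) prime-p′ p′∣p^k+1 with euclidsLemma p (p ^ k) prime-p′ p′∣p^k+1
  ... | inj₂ p′∣p^k = p-only k prime-p′ p′∣p^k
  ... | inj₁ p′∣p   = [ (λ p′≡1 → ⊥-elim (prime≢1 prime-p′ p′≡1)) , id ]′ (prime⇒irreducible prime-p p′∣p)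
  kernelSum-split : kernelSum s r q ≡ Φ + W
  kernelSum-split = trans (∑-divisors-prime^ m prime-p (λ e → kernelSize q e ^ s * (q div e) ^ r)) (cong₂ _+_
    (cong₂ _*_ (cong (_^ s) (kernelSize[n,1]≡φ q)) (trans (cong (_^ r) (div-1 q)) (^-*-assoc p m r)))
    (∑-cong (divisors q) λ {e} e∈ → 𝟙-guard (p ∣? e) λ p∣e → trans
      (cong (λ z → z ^ s * (q div e) ^ r) (kernelSize≡div (∈-divisors⁻ e∈)
        λ p′ prime-p′ p′∣q → subst (_∣ e) (sym (p-only m prime-p′ p′∣q)) p∣e))
      (sym (^-distribˡ-+-* (q div e) s r))))

-- Multiplicative functions as products over prime powers

module _ (T : ℕ → ℕ) (T-1 : T 1 ≡ 1)
  (T-* : ∀ {m n} → .{{NonZero m}} → .{{NonZero n}} → Coprime m n → T (m * n) ≡ T m * T n) where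

  -- Induction on the list of primes, splitting off one exact prime power at a time. The exponents
  -- are a fixed function `v` and not `expo p n`, because `n` shrinks to its cofactor while the
  -- exponents of the remaining primes stay the same.
  multiplicative-product : (ps : List ℕ) → Unique ps → All Prime ps → (v : ℕ → ℕ) →
    ∀ n → .{{NonZero n}} → (∀ {p} → p ∈ ps → p ^ v p ∥ n) → (∀ q → Prime q → q ∣ n → q ∈ ps) →
    T n ≡ product (map (λ p → T (p ^ v p)) ps)
  multiplicative-product [] _ _ v n _ covers with n ≟ 1
  ... | yes refl = T-1
  ... | no  n≢1 with primeDivisor n≢1
  ...   | q , prime-q , q∣n with covers q prime-q q∣n
  ...     | ()
  multiplicative-product (p ∷ ps) (p≉ps ∷ u) (prime-p ∷ primes) v n exact covers with exact (here refl)
  ... | divides n′ refl , p^v+1∤n =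
    trans (cong T (*-comm n′ (p ^ v p)))
      (trans (T-* {p ^ v p} {n′} (Coprime-^ (v p) (prime∤⇒coprime prime-p p∤n′)))
        (cong (T (p ^ v p) *_) (multiplicative-product ps u primes v n′ exact′ covers′)))
    where
    instance
      p^v≢0 : NonZero (p ^ v p)
      p^v≢0 = m^n≢0 p (v p) {{prime⇒nonZero prime-p}}
      n′≢0 : NonZero n′
      n′≢0 = ∣⇒nonZero (m∣m*n {n′} (p ^ v p))
    p∤n′ : ¬ p ∣ n′
    p∤n′ p∣n′ = p^v+1∤n (*-monoˡ-∣ (p ^ v p) p∣n′)
    exact′ : ∀ {q} → q ∈ ps → q ^ v q ∥ n′
    exact′ {q} q∈ with exact (there q∈)
    ... | q^v∣n , q^v+1∤n =
      coprime-divisor (Coprime-^ (v q) (Coprimality.sym (Coprime-^ (v p) p⊥q)))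
        (subst (q ^ v q ∣_) (*-comm n′ (p ^ v p)) q^v∣n) ,
      λ h → q^v+1∤n (∣m⇒∣m*n (p ^ v p) h)
      where
      p⊥q : Coprime p q
      p⊥q = prime∤⇒coprime prime-p λ p∣q →
        [ prime≢1 prime-p , All.lookup p≉ps q∈ ]′ (prime⇒irreducible (All.lookup primes q∈) p∣q)
    covers′ : ∀ q → Prime q → q ∣ n′ → q ∈ ps
    covers′ q prime-q q∣n′ with covers q prime-q (∣m⇒∣m*n (p ^ v p) q∣n′)
    ... | here refl = ⊥-elim (p∤n′ q∣n′)
    ... | there q∈  = q∈

  multiplicative⇒primePowerProduct : (f : ℕ → ℕ → ℕ) → (∀ p m → Prime p → T (p ^ m) ≡ f p m) →
    ∀ n → .{{NonZero n}} → T n ≡ primePowerProduct n f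
  multiplicative⇒primePowerProduct f T-p^ n = trans
    (multiplicative-product ps unique (All.tabulate prime∈) (λ p → expo p n) n
      (λ p∈ → ∥-expo (prime∈ p∈)) covers)
    (map-cong-prime ps prime∈)
    where
    primes≤n = filter prime? (upTo (suc n))
    ps = filter (λ p → p ∣? n) primes≤n
    unique : Unique ps
    unique = Unique.filter⁺ (λ p → p ∣? n) (Unique.filter⁺ prime? (Unique.upTo⁺ (suc n)))
    prime∈ : ∀ {p} → p ∈ ps → Prime p
    prime∈ p∈ = proj₂ (∈-filter⁻ prime? {xs = upTo (suc n)} (proj₁ (∈-filter⁻ (λ p → p ∣? n) {xs = primes≤n} p∈)))
    covers : ∀ q → Prime q → q ∣ n → q ∈ ps
    covers q prime-q q∣n = ∈-filter⁺ (λ p → p ∣? n) (∈-filter⁺ prime? (∈-upTo⁺ (s≤s (∣⇒≤ q∣n))) prime-q) q∣n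
    map-cong-prime : ∀ qs → (∀ {p} → p ∈ qs → Prime p) →
      product (map (λ p → T (p ^ expo p n)) qs) ≡ product (map (λ p → f p (expo p n)) qs)
    map-cong-prime []       _      = refl
    map-cong-prime (q ∷ qs) primes =
      cong₂ _*_ (T-p^ q (expo q n) (primes (here refl))) (map-cong-prime qs (primes ∘ there))

-- In `d ∣ e * f` the condition falls on `e` alone, since `f` divides `n₁` and is coprime to `d`.
-- The sum over `f` is therefore unrestricted.
restrictedKernelSum : ∀ s r {d n₀ n₁} .{{_ : NonZero n₀}} .{{_ : NonZero n₁}} →
  Coprime n₀ n₁ → d ∣ n₀ → (∀ p → Prime p → p ∣ n₀ → p ∣ d) →
  ∑ (divisors (n₀ * n₁)) (λ e → 𝟙[ d ∣? e ] * (kernelSize (n₀ * n₁) e ^ s * ((n₀ * n₁) div e) ^ r))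
    ≡ σ (s + r) (n₀ div d) * kernelSum s r n₁
restrictedKernelSum s r {d} {n₀} {n₁} cop d∣n₀ primes = begin
  ∑ (divisors (n₀ * n₁)) (λ e → 𝟙[ d ∣? e ] * (kernelSize (n₀ * n₁) e ^ s * ((n₀ * n₁) div e) ^ r))
    ≡⟨ ∑-divisors-* cop _ ⟩
  ∑ (divisors n₀) (λ e → ∑ (divisors n₁) (λ f →
    𝟙[ d ∣? e * f ] * (kernelSize (n₀ * n₁) (e * f) ^ s * ((n₀ * n₁) div (e * f)) ^ r)))
    ≡⟨ ∑-cong (divisors n₀) (λ {e} e∈ → ∑-cong (divisors n₁) (λ {f} f∈ →
         trans (cong₂ _*_
           (𝟙-cong (d ∣? e * f) (d ∣? e)
             (λ d∣ef → coprime-divisor (Coprime-∣ d∣n₀ (∈-divisors⁻ f∈) cop) (subst (d ∣_) (*-comm e f) d∣ef))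
             (∣m⇒∣m*n f))
           (kernelTerm-* s r cop (∈-divisors⁻ e∈) (∈-divisors⁻ f∈)))
         (trans (sym (*-assoc 𝟙[ d ∣? e ] _ _)) (cong₂ _*_ (local e∈) refl)))) ⟩
  ∑ (divisors n₀) (λ e → ∑ (divisors n₁) (λ f →
    (𝟙[ d ∣? e ] * (n₀ div e) ^ (s + r)) * (kernelSize n₁ f ^ s * (n₁ div f) ^ r)))
    ≡⟨ ∑-product (divisors n₀) (divisors n₁) _ _ ⟩
  ∑ (divisors n₀) (λ e → 𝟙[ d ∣? e ] * (n₀ div e) ^ (s + r)) * kernelSum s r n₁
    ≡⟨ cong (_* kernelSum s r n₁) (∑-complementary≡σ (s + r) d∣n₀) ⟩
  σ (s + r) (n₀ div d) * kernelSum s r n₁ ∎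
  where
  open ≡-Reasoning
  local : ∀ {e} → e ∈ divisors n₀ →
    𝟙[ d ∣? e ] * (kernelSize n₀ e ^ s * (n₀ div e) ^ r) ≡ 𝟙[ d ∣? e ] * (n₀ div e) ^ (s + r)
  local {e} e∈ = 𝟙-guard (d ∣? e) λ d∣e → trans
    (cong (λ z → z ^ s * (n₀ div e) ^ r)
      (kernelSize≡div (∈-divisors⁻ e∈) λ p prime-p p∣n₀ → ∣-trans (primes p prime-p p∣n₀) d∣e))
    (sym (^-distribˡ-+-* (n₀ div e) s r))

-- The two congruences are compatible because `u` is 1 modulo `gcd d e`. A solution is coprime to
-- `d` like `u` and to `e` like 1, so `unit-lift` can move it within its class modulo `d * e` to a
-- unit modulo `n`.
unitInClasses : ∀ {u d e n} .{{_ : NonZero n}} → d ∣ n → e ∣ n → Coprime u n → u ≅ 1 ⟨ gcd d e ⟩ →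
  ∃ λ v → Coprime v n × v ≅ u ⟨ d ⟩ × v ≅ 1 ⟨ e ⟩
unitInClasses {e = zero} {n} d∣n e∣n = ⊥-elim (≢-nonZero⁻¹ n (0∣⇒≡0 e∣n))
unitInClasses {u} {d} {e@(suc e′)} {n} d∣n e∣n cop-u (shifted x y u+xg≡1+yg) with negatedBézout d e
... | k , divides w kd+g≡we =
  let v , v≅v₀ , cop-v = unit-lift n cop-v₀ in
  v , cop-v , ≅-trans (≅-coarsen (m∣m*n e) v≅v₀) v₀≅u , ≅-trans (≅-coarsen (n∣m*n d) v≅v₀) v₀≅1
  where
  open ≡-Reasoning
  g = gcd d e
  -- Modulo `e`, `k * d` is -g, and u - 1 = (y - x) g. So u + t d is 1 for t = (y - x) k, where -1
  -- is written as `e′`.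
  t = y * k + x * k * e′
  v₀ = u + t * d
  v₀≅u : v₀ ≅ u ⟨ d ⟩
  v₀≅u = ≅-+multiple u t d
  ring₁ : ∀ u x y k e′ d g → u + (y * k + x * k * e′) * d + x * (k * d + g) ≡ (u + x * g) + (y * k * d + x * k * d * suc e′)
  ring₁ = solve-∀
  ring₂ : ∀ x y k e′ d g → (1 + y * g) + (y * k * d + x * k * d * suc e′) ≡ 1 + (y * (k * d + g) + x * k * d * suc e′)
  ring₂ = solve-∀
  ring₃ : ∀ x y k e′ d w → 1 + (y * (w * suc e′) + x * k * d * suc e′) ≡ 1 + (y * w + x * k * d) * suc e′
  ring₃ = solve-∀
  v₀≅1 : v₀ ≅ 1 ⟨ e ⟩
  v₀≅1 = shifted (x * w) (y * w + x * k * d) (begin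
    v₀ + x * w * e                                ≡⟨ cong (v₀ +_) (*-assoc x w e) ⟩
    v₀ + x * (w * e)                              ≡⟨ cong (λ z → v₀ + x * z) (sym kd+g≡we) ⟩
    v₀ + x * (k * d + g)                          ≡⟨ ring₁ u x y k e′ d g ⟩
    (u + x * g) + (y * k * d + x * k * d * e)     ≡⟨ cong (_+ (y * k * d + x * k * d * e)) u+xg≡1+yg ⟩
    (1 + y * g) + (y * k * d + x * k * d * e)     ≡⟨ ring₂ x y k e′ d g ⟩
    1 + (y * (k * d + g) + x * k * d * e)         ≡⟨ cong (λ z → 1 + (y * z + x * k * d * e)) kd+g≡we ⟩
    1 + (y * (w * e) + x * k * d * e)             ≡⟨ ring₃ x y k e′ d w ⟩
    1 + (y * w + x * k * d) * e                   ∎)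
  cop-v₀ : Coprime v₀ (d * e)
  cop-v₀ = Coprimality.sym (Coprime-* {d} {e}
    (Coprimality.sym (Coprime-resp-≅ v₀≅u (Coprime-∣ ∣-refl d∣n cop-u)))
    (Coprimality.sym (Coprime-resp-≅ v₀≅1 (Coprimality.1-coprimeTo e))))

-- Divisibility of gcds and by lcms as products of indicators

∏-constant : ∀ k c → ∏ k (λ _ → c) ≡ c ^ k
∏-constant zero    c = refl
∏-constant (suc k) c = cong (c *_) (∏-constant k c)

foldr-gcd-∣ : ∀ n xs → foldr gcd n xs ∣ n
foldr-gcd-∣ n []       = ∣-refl
foldr-gcd-∣ n (x ∷ xs) = ∣-trans (gcd[m,n]∣n x (foldr gcd n xs)) (foldr-gcd-∣ n xs)

𝟙-gcd : ∀ e x y → 𝟙[ e ∣? gcd x y ] ≡ 𝟙[ e ∣? x ] * 𝟙[ e ∣? y ]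
𝟙-gcd e x y = 𝟙-× (e ∣? gcd x y) (e ∣? x) (e ∣? y)
  (λ e∣g → ∣-trans e∣g (gcd[m,n]∣m x y)) (λ e∣g → ∣-trans e∣g (gcd[m,n]∣n x y)) gcd-greatest

𝟙-foldr-gcd : ∀ {e n k} (v : Vec ℕ k) → e ∣ n →
  𝟙[ e ∣? foldr gcd n (Vec.toList v) ] ≡ ∏ k (λ i → 𝟙[ e ∣? lookup v i ])
𝟙-foldr-gcd {e} {n} [] e∣n = 𝟙-true (e ∣? n) e∣n
𝟙-foldr-gcd {e} (x ∷ v) e∣n = trans (𝟙-gcd e x _) (cong (𝟙[ e ∣? x ] *_) (𝟙-foldr-gcd v e∣n))

𝟙-foldr-gcd-++ : ∀ e n (h : ℕ → ℕ) {k} (v : Vec ℕ k) ys →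
  𝟙[ e ∣? foldr gcd n (Vec.toList (Vec.map h v) ++ ys) ] ≡
  ∏ k (λ i → 𝟙[ e ∣? h (lookup v i) ]) * 𝟙[ e ∣? foldr gcd n ys ]
𝟙-foldr-gcd-++ e n h [] ys = sym (*-identityˡ _)
𝟙-foldr-gcd-++ e n h (x ∷ v) ys = trans (𝟙-gcd e (h x) _)
  (trans (cong (𝟙[ e ∣? h x ] *_) (𝟙-foldr-gcd-++ e n h v ys)) (sym (*-assoc 𝟙[ e ∣? h x ] _ _)))

-- Here the lcm of the conductors enters: the factors are the values of the separate character sums,
-- and their conditions merge into a single one.
𝟙-lcmList : ∀ e K s (ds : Fin s → ℕ) →
  ∏ s (λ i → 𝟙[ ds i ∣? e ] * K) ≡ 𝟙[ lcmList (toList ds) ∣? e ] * K ^ s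
𝟙-lcmList e K zero    ds = sym (trans (*-identityʳ _) (𝟙-true (1 ∣? e) (1∣ e)))
𝟙-lcmList e K (suc s) ds = begin
  𝟙[ d ∣? e ] * K * ∏ s (λ i → 𝟙[ ds (suc i) ∣? e ] * K) ≡⟨ cong (𝟙[ d ∣? e ] * K *_) (𝟙-lcmList e K s (ds ∘ suc)) ⟩
  𝟙[ d ∣? e ] * K * (𝟙[ l ∣? e ] * K ^ s)                ≡⟨ ring 𝟙[ d ∣? e ] K 𝟙[ l ∣? e ] (K ^ s) ⟩
  𝟙[ d ∣? e ] * 𝟙[ l ∣? e ] * (K * K ^ s)                ≡⟨ cong (_* (K * K ^ s)) (sym (𝟙-× (lcm d l ∣? e) (d ∣? e) (l ∣? e)
    (∣-trans (m∣lcm[m,n] d l)) (∣-trans (n∣lcm[m,n] d l)) lcm-least)) ⟩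
  𝟙[ lcm d l ∣? e ] * (K * K ^ s)                        ∎
  where
  open ≡-Reasoning
  d = ds zero
  l = lcmList (toList (ds ∘ suc))
  ring : ∀ a b c d → a * b * (c * d) ≡ a * c * (b * d)
  ring = solve-∀

lcmList-least : ∀ {n} s (ds : Fin s → ℕ) → (∀ i → ds i ∣ n) → lcmList (toList ds) ∣ n
lcmList-least zero    ds ds∣n = 1∣ _
lcmList-least (suc s) ds ds∣n = lcm-least (ds∣n zero) (lcmList-least s (ds ∘ suc) (ds∣n ∘ suc))

-- A constructive way to pull a fixed alternative out of a finite universal statement. `Z` will be
-- the vanishing of a character sum, which does not depend on the entry.
all-or : ∀ {ℓ₁ ℓ₂} {A : Set} {Z : Set ℓ₁} {P : A → Set ℓ₂} (xs : List A) →
  (∀ {x} → x ∈ xs → Z ⊎ P x) → Z ⊎ (∀ {x} → x ∈ xs → P x)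
all-or []       h = inj₂ λ ()
all-or (x ∷ xs) h with h (here refl) | all-or xs (h ∘ there)
... | inj₁ z  | _       = inj₁ z
... | inj₂ _  | inj₁ z  = inj₁ z
... | inj₂ px | inj₂ ps = inj₂ λ { (here refl) → px ; (there x∈) → ps x∈ }

-- Character sums

module _ {c ℓ : Level} (R : CommutativeRing c ℓ) where
  private
    module R = CommutativeRing R
    module ∑R = Summation R.commutativeSemiring
    module *P = CommutativeSemigroupProperties R.*-commutativeSemigroup
  open R using (_≈_) renaming (_+_ to _⊕_; _*_ to _⊗_; 0# to 𝟘; 1# to 𝟙)
  open RingProperties R.ring using (-1*x≈-x; x∙y⁻¹≈ε⇒x≈y)
  open SetoidReasoning R.setoid

  private
    ι : ℕ → R.Carrier
    ι = fromℕ R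

  fromℕ-+ : ∀ m n → ι (m + n) ≈ ι m ⊕ ι n
  fromℕ-+ zero    n = R.sym (R.+-identityˡ _)
  fromℕ-+ (suc m) n = R.trans (R.+-congˡ (fromℕ-+ m n)) (R.sym (R.+-assoc _ _ _))

  fromℕ-* : ∀ m n → ι (m * n) ≈ ι m ⊗ ι n
  fromℕ-* zero    n = R.sym (R.zeroˡ _)
  fromℕ-* (suc m) n = begin
    ι (n + m * n)         ≈⟨ fromℕ-+ n (m * n) ⟩
    ι n ⊕ ι (m * n)       ≈⟨ R.+-cong (R.sym (R.*-identityˡ _)) (fromℕ-* m n) ⟩
    𝟙 ⊗ ι n ⊕ ι m ⊗ ι n   ≈⟨ R.sym (R.distribʳ _ _ _) ⟩
    (𝟙 ⊕ ι m) ⊗ ι n       ∎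

  fromℕ-≡ : ∀ {m n} → m ≡ n → ι m ≈ ι n
  fromℕ-≡ m≡n = R.reflexive (cong ι m≡n)

  fromℕ-∑ : {A : Set} (xs : List A) (f : A → ℕ) → ι (∑ xs f) ≈ ∑R.∑ xs (ι ∘ f)
  fromℕ-∑ []       f = R.refl
  fromℕ-∑ (x ∷ xs) f = R.trans (fromℕ-+ (f x) (∑ xs f)) (R.+-congˡ (fromℕ-∑ xs f))

  fromℕ-𝟙 : {P : Set} (p : Dec P) → ι 𝟙[ p ] ≈ ∑R.𝟙[ p ]
  fromℕ-𝟙 (yes _) = R.+-identityʳ 𝟙
  fromℕ-𝟙 (no _)  = R.refl

  fromℕ-∏ : ∀ k (f : Fin k → ℕ) → ι (∏ k f) ≈ ∑R.∏ k (ι ∘ f)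
  fromℕ-∏ zero    f = R.+-identityʳ 𝟙
  fromℕ-∏ (suc k) f = R.trans (fromℕ-* (f zero) (∏ k (f ∘ suc))) (R.*-congˡ (fromℕ-∏ k (f ∘ suc)))

  prodR-tabulate : ∀ k (f : Fin k → R.Carrier) → prodR R (Vec.toList (Vec.tabulate f)) ≡ ∑R.∏ k f
  prodR-tabulate zero    f = refl
  prodR-tabulate (suc k) f = cong (f zero ⊗_) (prodR-tabulate k (f ∘ suc))

  -- Conductors and orthogonality on kernels

  module _ {n : ℕ} .{{_ : NonZero n}} (X : DirichletCharacter R n) where

    TrivialOnKernel : ℕ → Set ℓ
    TrivialOnKernel e = ∀ u → Coprime u n → u ≅ 1 ⟨ e ⟩ → χ X u ≈ 𝟙

    χ-+multiple : ∀ a k → χ X (a + k * n) ≈ χ X a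
    χ-+multiple a zero    = R.reflexive (cong (χ X) (+-identityʳ a))
    χ-+multiple a (suc k) = R.trans (R.reflexive (cong (χ X) (ring a k n)))
      (R.trans (periodic X (a + k * n)) (χ-+multiple a k))
      where
      ring : ∀ a k n → a + (n + k * n) ≡ a + k * n + n
      ring = solve-∀

    χ-≅ : ∀ {a b} → a ≅ b ⟨ n ⟩ → χ X a ≈ χ X b
    χ-≅ {a} {b} (shifted x y eq) =
      R.trans (R.sym (χ-+multiple a x)) (R.trans (R.reflexive (cong (χ X) eq)) (χ-+multiple b y))

    -- With `w` inverse to `b`, the product `a * w` lies in the kernel, and `a` is `a * w * b`
    -- modulo `n`.
    trivialOnKernel⇒induced : ∀ {e} → e ∣ n → TrivialOnKernel e → InducedMod R X e
    trivialOnKernel⇒induced {e} e∣n trivial a b cop-a cop-b a≡b with inverse cop-b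
    ... | w , bw≅1 , cop-w = begin
      χ X a                ≈⟨ χ-≅ (≅-sym awb≅a) ⟩
      χ X (a * w * b)      ≈⟨ multiplicative X (a * w) b ⟩
      χ X (a * w) ⊗ χ X b  ≈⟨ R.*-congʳ (trivial (a * w) (Coprime-* {a} {w} cop-a cop-w) aw≅1) ⟩
      𝟙 ⊗ χ X b            ≈⟨ R.*-identityˡ _ ⟩
      χ X b                ∎
      where
      aw≅1 : a * w ≅ 1 ⟨ e ⟩
      aw≅1 = ≅-trans (≅-* ([mod]⇒≅ {a} {b} a≡b) (≅-refl {w})) (≅-coarsen e∣n bw≅1)
      ring : ∀ a w b → a * (b * w) ≡ a * w * b
      ring = solve-∀
      awb≅a : a * w * b ≅ a ⟨ n ⟩
      awb≅a = subst₂ (_≅_⟨ n ⟩) (ring a w b) (*-identityʳ a) (≅-* (≅-refl {a}) bw≅1)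

    induced⇒trivialOnKernel : ∀ {e} → InducedMod R X e → TrivialOnKernel e
    induced⇒trivialOnKernel induced u cop-u u≅1 =
      R.trans (induced u 1 cop-u (Coprimality.1-coprimeTo n) (≅⇒[mod] u≅1)) (χ-one X)

    -- Triviality on the kernels for d and for e gives triviality for gcd d e, so minimality forces gcd d e = d.
    conductor-∣ : ∀ {d e} → IsConductor R X d → e ∣ n → TrivialOnKernel e → d ∣ e
    conductor-∣ {d} {e} (1≤d , d∣n , induced , least) e∣n trivial = subst (_∣ e) g≡d (gcd[m,n]∣n d e)
      where
      instance
        d≢0 : NonZero d
        d≢0 = >-nonZero 1≤d
      g∣n : gcd d e ∣ n
      g∣n = ∣-trans (gcd[m,n]∣m d e) d∣n
      instance
        g≢0 : NonZero (gcd d e)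
        g≢0 = ∣⇒nonZero g∣n
      trivial-g : TrivialOnKernel (gcd d e)
      trivial-g u cop-u u≅1 with unitInClasses d∣n e∣n cop-u u≅1
      -- χ(u) = χ(v) because χ is induced modulo `d`, and χ(v) = 1 because `v` lies in the kernel
      -- for `e`.
      ... | v , cop-v , v≅u , v≅1 =
        R.trans (R.sym (induced v u cop-v cop-u (≅⇒[mod] v≅u))) (trivial v cop-v v≅1)
      g≡d : gcd d e ≡ d
      g≡d = ≤-antisym (∣⇒≤ (gcd[m,n]∣m d e))
        (least (gcd d e) (n≢0⇒n>0 (≢-nonZero⁻¹ (gcd d e))) g∣n (trivialOnKernel⇒induced g∣n trivial-g))

    kernelCharacterSum : ℕ → R.Carrier
    kernelCharacterSum e = ∑R.∑ (units n) (λ a → ∑R.𝟙[ a ≅? 1 ⟨ e ⟩ ] ⊗ χ X a)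

    -- Substituting u a for a permutes the kernel and multiplies every term by χ(u).
    kernelCharacterSum-invariant : ∀ {e} → e ∣ n → ∀ u → Coprime u n → u ≅ 1 ⟨ e ⟩ →
      χ X u ⊗ kernelCharacterSum e ≈ kernelCharacterSum e
    kernelCharacterSum-invariant {e} e∣n u cop-u u≅1 = begin
      χ X u ⊗ kernelCharacterSum e
        ≈⟨ R.sym (∑R.∑-distribˡ (χ X u) (units n) _) ⟩
      ∑R.∑ (units n) (λ a → χ X u ⊗ (∑R.𝟙[ a ≅? 1 ⟨ e ⟩ ] ⊗ χ X a))
        ≈⟨ ∑R.∑-cong (units n) (λ {a} _ → R.trans (*P.x∙yz≈y∙xz _ _ _) (R.*-cong
             (∑R.𝟙-cong (a ≅? 1 ⟨ e ⟩) ((u * a % n) ≅? 1 ⟨ e ⟩)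
               (≅-trans (ua%n≅a a)) (≅-trans (≅-sym (ua%n≅a a))))
             (R.sym (R.trans (χ-≅ (≅-% (u * a) n)) (multiplicative X u a))))) ⟩
      ∑R.∑ (units n) (λ a → ∑R.𝟙[ (u * a % n) ≅? 1 ⟨ e ⟩ ] ⊗ χ X (u * a % n))
        ≈⟨ ∑R.∑-reindex (unitShift cop-u) (λ a → ∑R.𝟙[ a ≅? 1 ⟨ e ⟩ ] ⊗ χ X a) ⟩
      kernelCharacterSum e ∎
      where
      ua%n≅a : ∀ a → u * a % n ≅ a ⟨ e ⟩
      ua%n≅a a = ≅-trans (≅-coarsen e∣n (≅-% (u * a) n))
        (subst (u * a ≅_⟨ e ⟩) (*-identityˡ a) (≅-* u≅1 (≅-refl {a})))

    -- Equality in R need not be decidable; instead the absence of zero divisors is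
    -- applied to (χ u - 1) · Σ = 0 for each of the finitely many u in the kernel.
    vanishing-or-trivial : IsCharZeroDomain R → ∀ {e} → e ∣ n → kernelCharacterSum e ≈ 𝟘 ⊎ TrivialOnKernel e
    vanishing-or-trivial dom {e} e∣n with all-or (units n) decide
      where
      decide : ∀ {u} → u ∈ units n → kernelCharacterSum e ≈ 𝟘 ⊎ (u ≅ 1 ⟨ e ⟩ → χ X u ≈ 𝟙)
      decide {u} u∈ with u ≅? 1 ⟨ e ⟩
      ... | no  u≇1 = inj₂ λ u≅1 → ⊥-elim (u≇1 u≅1)
      ... | yes u≅1 = [ (λ χu-1≈0 → inj₂ λ _ → x∙y⁻¹≈ε⇒x≈y _ _ χu-1≈0) , inj₁ ]′
        (IsCharZeroDomain.noZeroDiv dom (χ X u ⊕ R.- 𝟙) (kernelCharacterSum e) (begin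
          (χ X u ⊕ R.- 𝟙) ⊗ S         ≈⟨ R.distribʳ S (χ X u) (R.- 𝟙) ⟩
          χ X u ⊗ S ⊕ (R.- 𝟙) ⊗ S     ≈⟨ R.+-cong (kernelCharacterSum-invariant e∣n u (proj₂ (∈-units⁻ u∈)) u≅1) (-1*x≈-x S) ⟩
          S ⊕ R.- S                   ≈⟨ R.-‿inverseʳ S ⟩
          𝟘                           ∎))
        where S = kernelCharacterSum e
    ... | inj₁ vanishes = inj₁ vanishes
    ... | inj₂ trivial  = inj₂ λ u cop-u u≅1 → R.trans (χ-≅ (≅-sym (≅-% u n)))
      (trivial (%-∈-units cop-u) (≅-trans (≅-coarsen e∣n (≅-% u n)) u≅1))

    -- For `d ∣ e` every term is 1. Otherwise the sum vanishes, since the other alternative,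
    -- triviality on the kernel, would force `d ∣ e`.
    kernelCharacterSum-value : IsCharZeroDomain R → ∀ {d e} → IsConductor R X d → e ∣ n →
      kernelCharacterSum e ≈ ι (𝟙[ d ∣? e ] * kernelSize n e)
    kernelCharacterSum-value dom {d} {e} conductor e∣n with d ∣? e
    ... | yes d∣e = begin
      kernelCharacterSum e
        ≈⟨ ∑R.∑-cong (units n) (λ {a} a∈ → R.trans
             (∑R.𝟙-guard (a ≅? 1 ⟨ e ⟩) λ a≅1 → induced⇒trivialOnKernel (proj₁ (proj₂ (proj₂ conductor))) a
               (proj₂ (∈-units⁻ a∈)) (≅-coarsen d∣e a≅1))
             (R.trans (R.*-identityʳ _) (R.sym (fromℕ-𝟙 (a ≅? 1 ⟨ e ⟩))))) ⟩
      ∑R.∑ (units n) (λ a → ι 𝟙[ a ≅? 1 ⟨ e ⟩ ])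
        ≈⟨ R.sym (fromℕ-∑ (units n) _) ⟩
      ι (kernelSize n e)
        ≈⟨ fromℕ-≡ (sym (*-identityˡ (kernelSize n e))) ⟩
      ι (1 * kernelSize n e) ∎
    ... | no d∤e with vanishing-or-trivial dom e∣n
    ...   | inj₁ vanishes = vanishes
    ...   | inj₂ trivial  = ⊥-elim (d∤e (conductor-∣ conductor e∣n trivial))

  -- Expansion of the gcd sum

  gcdSum≈kernelSums : ∀ {n} .{{_ : NonZero n}} s r → IsCharZeroDomain R →
    (X : Fin s → DirichletCharacter R n) (ds : Fin s → ℕ) → (∀ i → IsConductor R (X i) (ds i)) →
    gcdSum R n s r X ≈ ι (∑ (divisors n) (λ e →
      φ e * ((𝟙[ lcmList (toList ds) ∣? e ] * kernelSize n e ^ s) * (n div e) ^ r)))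
  gcdSum≈kernelSums {n} s r dom X ds conductor = begin
    gcdSum R n s r X
      ≈⟨ ∑R.total-concatMap _ As ⟩
    ∑R.∑ As (λ as → ∑R.∑ Bs (λ bs → ι (g as bs) ⊗ prodR R (Vec.toList (Vec.tabulate (λ i → χ (X i) (lookup as i))))))
      ≈⟨ ∑R.∑-cong As (λ {as} _ → ∑R.∑-cong Bs (λ {bs} _ → expand as bs)) ⟩
    ∑R.∑ As (λ as → ∑R.∑ Bs (λ bs → ∑R.∑ D (λ e → ι (φ e) ⊗ (P e as ⊗ ι (Q e bs)))))
      ≈⟨ ∑R.∑-cong As (λ _ → ∑R.∑-swap Bs D _) ⟩
    ∑R.∑ As (λ as → ∑R.∑ D (λ e → ∑R.∑ Bs (λ bs → ι (φ e) ⊗ (P e as ⊗ ι (Q e bs)))))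
      ≈⟨ ∑R.∑-swap As D _ ⟩
    ∑R.∑ D (λ e → ∑R.∑ As (λ as → ∑R.∑ Bs (λ bs → ι (φ e) ⊗ (P e as ⊗ ι (Q e bs)))))
      ≈⟨ ∑R.∑-cong D (λ {e} e∈ → evaluate e (∈-divisors⁻ e∈)) ⟩
    ∑R.∑ D (λ e → ι (φ e * ((𝟙[ lcmList (toList ds) ∣? e ] * kernelSize n e ^ s) * (n div e) ^ r)))
      ≈⟨ R.sym (fromℕ-∑ D _) ⟩
    ι (∑ D (λ e → φ e * ((𝟙[ lcmList (toList ds) ∣? e ] * kernelSize n e ^ s) * (n div e) ^ r))) ∎
    where
    As = tuples (units n) s
    Bs = tuples (ℤ/ n) r
    D  = divisors n
    g : Vec ℕ s → Vec ℕ r → ℕ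
    g as bs = foldr gcd n (Vec.toList (Vec.map (_∸ 1) as) ++ Vec.toList bs)
    -- `P` merges the condition on each a_i with its character value, so that its sum over tuples
    -- factors into kernel character sums. `Q` carries no characters and is evaluated in ℕ.
    P : ℕ → Vec ℕ s → R.Carrier
    P e as = ∑R.∏ s (λ i → ∑R.𝟙[ e ∣? (lookup as i ∸ 1) ] ⊗ χ (X i) (lookup as i))
    Q : ℕ → Vec ℕ r → ℕ
    Q e bs = ∏ r (λ j → 𝟙[ e ∣? lookup bs j ])
    I : ℕ → Vec ℕ s → ℕ
    I e as = ∏ s (λ i → 𝟙[ e ∣? (lookup as i ∸ 1) ])

    split : ∀ e as bs → e ∣ n → 𝟙[ e ∣? g as bs ] ≡ I e as * Q e bs
    split e as bs e∣n =
      trans (𝟙-foldr-gcd-++ e n (_∸ 1) as (Vec.toList bs)) (cong (I e as *_) (𝟙-foldr-gcd bs e∣n))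

    P≈ : ∀ e as → ι (I e as) ⊗ ∑R.∏ s (λ i → χ (X i) (lookup as i)) ≈ P e as
    P≈ e as = R.trans (R.*-congʳ (R.trans (fromℕ-∏ s _) (∑R.∏-cong s λ i → fromℕ-𝟙 (e ∣? (lookup as i ∸ 1)))))
      (R.sym (∑R.∏-⊗ s _ _))

    expand : ∀ as bs → ι (g as bs) ⊗ prodR R (Vec.toList (Vec.tabulate (λ i → χ (X i) (lookup as i)))) ≈
      ∑R.∑ D (λ e → ι (φ e) ⊗ (P e as ⊗ ι (Q e bs)))
    expand as bs = begin
      ι (g as bs) ⊗ prodR R (Vec.toList (Vec.tabulate (λ i → χ (X i) (lookup as i))))
        ≈⟨ R.*-cong (fromℕ-≡ (sym (∑φ-common (foldr-gcd-∣ n (Vec.toList (Vec.map (_∸ 1) as) ++ Vec.toList bs))))) (R.reflexive (prodR-tabulate s _)) ⟩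
      ι (∑ D (λ e → 𝟙[ e ∣? g as bs ] * φ e)) ⊗ Π
        ≈⟨ R.*-congʳ (fromℕ-∑ D _) ⟩
      ∑R.∑ D (λ e → ι (𝟙[ e ∣? g as bs ] * φ e)) ⊗ Π
        ≈⟨ R.sym (∑R.∑-distribʳ D _ Π) ⟩
      ∑R.∑ D (λ e → ι (𝟙[ e ∣? g as bs ] * φ e) ⊗ Π)
        ≈⟨ ∑R.∑-cong D (λ {e} e∈ → begin
             ι (𝟙[ e ∣? g as bs ] * φ e) ⊗ Π
               ≈⟨ R.*-congʳ (fromℕ-≡ (trans (cong (_* φ e) (split e as bs (∈-divisors⁻ e∈))) (*-comm _ (φ e)))) ⟩
             ι (φ e * (I e as * Q e bs)) ⊗ Π
               ≈⟨ R.*-congʳ (R.trans (fromℕ-* (φ e) _) (R.*-congˡ (fromℕ-* (I e as) (Q e bs)))) ⟩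
             ι (φ e) ⊗ (ι (I e as) ⊗ ι (Q e bs)) ⊗ Π
               ≈⟨ R.trans (R.*-assoc _ _ _) (R.*-congˡ (*P.xy∙z≈xz∙y _ _ _)) ⟩
             ι (φ e) ⊗ (ι (I e as) ⊗ Π ⊗ ι (Q e bs))
               ≈⟨ R.*-congˡ (R.*-congʳ (P≈ e as)) ⟩
             ι (φ e) ⊗ (P e as ⊗ ι (Q e bs)) ∎) ⟩
      ∑R.∑ D (λ e → ι (φ e) ⊗ (P e as ⊗ ι (Q e bs))) ∎
      where Π = ∑R.∏ s (λ i → χ (X i) (lookup as i))

    ∑P : ∀ e → e ∣ n → ∑R.∑ As (P e) ≈ ι (𝟙[ lcmList (toList ds) ∣? e ] * kernelSize n e ^ s)
    ∑P e e∣n = begin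
      ∑R.∑ As (P e)
        ≈⟨ ∑R.∑-tuples (units n) s (λ i a → ∑R.𝟙[ e ∣? (a ∸ 1) ] ⊗ χ (X i) a) ⟩
      ∑R.∏ s (λ i → ∑R.∑ (units n) (λ a → ∑R.𝟙[ e ∣? (a ∸ 1) ] ⊗ χ (X i) a))
        ≈⟨ ∑R.∏-cong s (λ i → R.trans
             (∑R.∑-cong (units n) λ {a} a∈ → R.*-congʳ (∑R.𝟙-cong (e ∣? (a ∸ 1)) (a ≅? 1 ⟨ e ⟩)
               (proj₁ (∣∸1⇔≅1 a∈ e∣n)) (proj₂ (∣∸1⇔≅1 a∈ e∣n))))
             (kernelCharacterSum-value (X i) dom (conductor i) e∣n)) ⟩
      ∑R.∏ s (λ i → ι (𝟙[ ds i ∣? e ] * kernelSize n e))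
        ≈⟨ R.sym (fromℕ-∏ s _) ⟩
      ι (∏ s (λ i → 𝟙[ ds i ∣? e ] * kernelSize n e))
        ≈⟨ fromℕ-≡ (𝟙-lcmList e (kernelSize n e) s ds) ⟩
      ι (𝟙[ lcmList (toList ds) ∣? e ] * kernelSize n e ^ s) ∎

    ∑Q : ∀ e → e ∣ n → ∑ Bs (Q e) ≡ (n div e) ^ r
    ∑Q e e∣n = trans (∑-tuples (ℤ/ n) r (λ _ b → 𝟙[ e ∣? b ])) (trans
      (∏-constant r _) (cong (_^ r) (multiplesBelow {{∣⇒nonZero e∣n}} e∣n)))

    evaluate : ∀ e → e ∣ n → ∑R.∑ As (λ as → ∑R.∑ Bs (λ bs → ι (φ e) ⊗ (P e as ⊗ ι (Q e bs)))) ≈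
      ι (φ e * ((𝟙[ lcmList (toList ds) ∣? e ] * kernelSize n e ^ s) * (n div e) ^ r))
    evaluate e e∣n = begin
      ∑R.∑ As (λ as → ∑R.∑ Bs (λ bs → ι (φ e) ⊗ (P e as ⊗ ι (Q e bs))))
        ≈⟨ ∑R.∑-cong As (λ _ → ∑R.∑-distribˡ (ι (φ e)) Bs _) ⟩
      ∑R.∑ As (λ as → ι (φ e) ⊗ ∑R.∑ Bs (λ bs → P e as ⊗ ι (Q e bs)))
        ≈⟨ ∑R.∑-distribˡ (ι (φ e)) As _ ⟩
      ι (φ e) ⊗ ∑R.∑ As (λ as → ∑R.∑ Bs (λ bs → P e as ⊗ ι (Q e bs)))
        ≈⟨ R.*-congˡ (∑R.∑-product As Bs (P e) (ι ∘ Q e)) ⟩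
      ι (φ e) ⊗ (∑R.∑ As (P e) ⊗ ∑R.∑ Bs (ι ∘ Q e))
        ≈⟨ R.*-congˡ (R.*-cong (∑P e e∣n) (R.trans (R.sym (fromℕ-∑ Bs (Q e))) (fromℕ-≡ (∑Q e e∣n)))) ⟩
      ι (φ e) ⊗ (ι (𝟙[ lcmList (toList ds) ∣? e ] * kernelSize n e ^ s) ⊗ ι ((n div e) ^ r))
        ≈⟨ R.sym (R.trans (fromℕ-* (φ e) _) (R.*-congˡ (fromℕ-* (𝟙[ lcmList (toList ds) ∣? e ] * kernelSize n e ^ s) ((n div e) ^ r)))) ⟩
      ι (φ e * ((𝟙[ lcmList (toList ds) ∣? e ] * kernelSize n e ^ s) * (n div e) ^ r)) ∎

-- A common prime p of n₀ and n / n₀ would make n₀ * p a larger admissible divisor.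
maximal⇒coprime-cofactor : ∀ {d n n₀} .{{_ : NonZero n}} (n₀∣n : n₀ ∣ n) → SamePrimeFactors n₀ d →
  (∀ e → e ∣ n → SamePrimeFactors e d → e ≤ n₀) → Coprime n₀ (quotient n₀∣n)
maximal⇒coprime-cofactor {d} {n} {n₀} n₀∣n@(divides n₁ refl) same maximal = no-common-prime⇒coprime absurd
  where
  instance
    n₀≢0 : NonZero n₀
    n₀≢0 = ∣⇒nonZero n₀∣n
  absurd : ∀ p → Prime p → p ∣ n₀ → p ∣ n₁ → ⊥
  absurd p prime-p p∣n₀ p∣n₁ = <⇒≱ (m<m*n n₀ p (nonTrivial⇒n>1 p {{prime⇒nonTrivial prime-p}}))
    (maximal (n₀ * p) (subst (_∣ n₁ * n₀) (*-comm p n₀) (*-monoˡ-∣ n₀ p∣n₁)) same′)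
    where
    same′ : SamePrimeFactors (n₀ * p) d
    same′ q prime-q = mk⇔
      (λ q∣n₀p → Equivalence.to (same q prime-q) ([ id , (λ q∣p → ∣-trans q∣p p∣n₀) ]′ (euclidsLemma n₀ p prime-q q∣n₀p)))
      (λ q∣d → ∣m⇒∣m*n p (Equivalence.from (same q prime-q) q∣d))

-- Evaluation in ℕ and conclusion

∑φ-kernel : ∀ s r {d n₀ n₁} .{{_ : NonZero n₀}} .{{_ : NonZero n₁}} →
  Coprime n₀ n₁ → d ∣ n₀ → (∀ p → Prime p → p ∣ n₀ → p ∣ d) →
  ∑ (divisors (n₀ * n₁)) (λ e → φ e * ((𝟙[ d ∣? e ] * kernelSize (n₀ * n₁) e ^ suc s) * ((n₀ * n₁) div e) ^ r))
    ≡ φ (n₀ * n₁) * σ (s + r) (n₀ div d) * primePowerProduct n₁ (λ p m →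
        φ (p ^ m) ^ s * p ^ (m * r) + σ (s + r) (p ^ m) ∸ p ^ (m * (s + r)))
∑φ-kernel s r {d} {n₀} {n₁} cop d∣n₀ primes = begin
  ∑ (divisors n) (λ e → φ e * ((𝟙[ d ∣? e ] * kernelSize n e ^ suc s) * (n div e) ^ r))
    -- One of the `suc s` kernel factors is joined with `φ e` to give `φ n`, which no longer depends
    -- on `e`; exponent `s` remains.
    ≡⟨ ∑-cong (divisors n) (λ {e} e∈ → trans (ring (φ e) 𝟙[ d ∣? e ] (kernelSize n e) _ _)
         (cong (_* (𝟙[ d ∣? e ] * (kernelSize n e ^ s * (n div e) ^ r))) (φ*kernelSize {n} (∈-divisors⁻ e∈)))) ⟩
  ∑ (divisors n) (λ e → φ n * (𝟙[ d ∣? e ] * (kernelSize n e ^ s * (n div e) ^ r)))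
    ≡⟨ ∑-distribˡ (φ n) (divisors n) _ ⟩
  φ n * ∑ (divisors n) (λ e → 𝟙[ d ∣? e ] * (kernelSize n e ^ s * (n div e) ^ r))
    ≡⟨ cong (φ n *_) (restrictedKernelSum s r cop d∣n₀ primes) ⟩
  φ n * (σ (s + r) (n₀ div d) * kernelSum s r n₁)
    ≡⟨ sym (*-assoc (φ n) _ _) ⟩
  φ n * σ (s + r) (n₀ div d) * kernelSum s r n₁
    ≡⟨ cong (φ n * σ (s + r) (n₀ div d) *_) (multiplicative⇒primePowerProduct (kernelSum s r)
         (kernelSum-1 s r) (kernelSum-* s r) _ (λ p m → kernelSum-prime^ s r m) n₁) ⟩
  φ n * σ (s + r) (n₀ div d) * primePowerProduct n₁ (λ p m →
    φ (p ^ m) ^ s * p ^ (m * r) + σ (s + r) (p ^ m) ∸ p ^ (m * (s + r))) ∎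
  where
  open ≡-Reasoning
  n = n₀ * n₁
  instance _ = m*n≢0 n₀ n₁
  ring : ∀ a b c d e → a * (b * (c * d) * e) ≡ a * c * (b * (d * e))
  ring = solve-∀

theorem3p2 : {c ℓ : Level} (R : CommutativeRing c ℓ) → IsCharZeroDomain R →
    (r s n : ℕ) → 0 < s → 0 < n →
    (X : Fin s → DirichletCharacter R n) → (ds : Fin s → ℕ) →
    (∀ i → IsConductor R (X i) (ds i)) →
    (n₀ : ℕ) → n₀ ∣ n → SamePrimeFactors n₀ (lcmList (toList ds)) →
    (∀ e → e ∣ n → SamePrimeFactors e (lcmList (toList ds)) → e ≤ n₀) →
    CommutativeRing._≈_ R (gcdSum R n s r X)
    (fromℕ R (φ n * σ (s + r ∸ 1) (n₀ div lcmList (toList ds))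
    * primePowerProduct (n div n₀) (λ p m →
    (φ (p ^ m) ^ (s ∸ 1)) * p ^ (m * r) + σ (s + r ∸ 1) (p ^ m)
    ∸ p ^ (m * (s + r ∸ 1)))))
-- With `suc s` for the number of characters, the exponents `s ∸ 1` and `s + r ∸ 1` of the statement
-- compute to `s` and `s + r`.
theorem3p2 R dom r (suc s) n _ 0<n X ds conductor n₀ n₀∣n@(divides n₁ n≡n₁n₀) same maximal
  with trans n≡n₁n₀ (*-comm n₁ n₀)
... | refl = CommutativeRing.trans R
  (gcdSum≈kernelSums R (suc s) r dom X ds conductor)
  (CommutativeRing.reflexive R (cong (fromℕ R) (trans
    (∑φ-kernel s r cop d∣n₀ (λ p prime-p → Equivalence.to (same p prime-p)))
    (cong (λ m → φ n * σ (s + r) (n₀ div d) * primePowerProduct m (λ p m →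
      φ (p ^ m) ^ s * p ^ (m * r) + σ (s + r) (p ^ m) ∸ p ^ (m * (s + r))))
      (sym (trans (cong (_div n₀) (*-comm n₀ n₁)) (q*e-div-e n₁ n₀)))))))
  where
  d = lcmList (toList ds)
  instance
    n≢0 : NonZero (n₀ * n₁)
    n≢0 = >-nonZero 0<n
    n₀≢0 : NonZero n₀
    n₀≢0 = ∣⇒nonZero (m∣m*n {n₀} n₁)
    n₁≢0 : NonZero n₁
    n₁≢0 = ∣⇒nonZero (n∣m*n n₀ {n₁})
  cop : Coprime n₀ n₁
  cop = maximal⇒coprime-cofactor n₀∣n same maximal
  d⊥n₁ : Coprime d n₁
  d⊥n₁ = no-common-prime⇒coprime λ p prime-p p∣d p∣n₁ →
    prime≢1 prime-p (cop (Equivalence.from (same p prime-p) p∣d , p∣n₁))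
  -- Each conductor divides `n`, hence so does their lcm `d`; as `d` has no prime in common with the
  -- cofactor `n₁`, it divides `n₀`.
  d∣n₀ : d ∣ n₀
  d∣n₀ = coprime-divisor d⊥n₁ (subst (d ∣_) (*-comm n₀ n₁)
    (lcmList-least (suc s) ds λ i → proj₁ (proj₂ (conductor i))))
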